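{- Let $n\ge 7$ and let $G$ be a bipartite unit rectangle visibility graph with $n$ vertices. Then $$|E(G)|\le 4n-2\lceil\sqrt{n}\,\rceil+5.$$
   Context: A finite simple graph $G$ is a unit rectangle visibility graph (URVG) if its vertices $v$ can be represented by closed unit squares $S_v$ in the plane with sides parallel to the coordinate axes and with pairwise disjoint interiors (squares may touch along their boundaries), in such a way that two distinct vertices $v,w$ are adjacent if and only if there is an unobstructed non-degenerate (positive width) horizontal or vertical band of visibility joining $S_v$ and $S_w$. Here a horizontal band of visibility joining $S_v$ and $S_w$ is given by an open interval $I$ of positive length such that for every $y_0\in I$ the line $y=y_0$ meets the interiors of both $S_v$ and $S_w$, and the part of this line between $S_v$ and $S_w$ (possibly a single point if the squares touch) meets the interior of no other square of the representation; vertical bands are defined analogously with the roles of $x$ and $y$ exchanged. -}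

module Defs where

open import Data.Bool using (Bool)
open import Data.Empty using (⊥)
open import Data.Fin as Fin using (Fin)
import Data.Fin.Properties as Fin
open import Data.List using (List; length; filter; cartesianProduct; allFin)
open import Data.Nat as ℕ using (ℕ; zero; suc; z≤n; s≤s)
import Data.Nat.Properties as ℕ
open import Data.Product using (Σ; ∃; ∃-syntax; _×_; _,_)
open import Data.Rational as ℚ using (ℚ; 1ℚ)
import Data.Rational.Properties as ℚ
open import Data.Sum using (_⊎_)
open import Function.Base using (_∘_)
open import Function.Bundles using (_⇔_)
open import Relation.Binary.Definitions using (Decidable; Symmetric; Irreflexive)
open import Relation.Binary.PropositionalEquality
open import Relation.Nullary using (¬_; yes; no)
open import Relation.Nullary.Decidable using (_×-dec_)

-- Real numbers as two-sided located Dedekind cuts of ℚ.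

record ℝ : Set₁ where
  field
    Lower Upper     : ℚ → Set
    lower-inhabited : ∃ Lower
    upper-inhabited : ∃ Upper
    lower-downward  : ∀ {q r} → q ℚ.< r → Lower r → Lower q
    upper-upward    : ∀ {q r} → q ℚ.< r → Upper q → Upper r
    lower-rounded   : ∀ {q} → Lower q → ∃[ r ] (q ℚ.< r × Lower r)
    upper-rounded   : ∀ {r} → Upper r → ∃[ q ] (q ℚ.< r × Upper q)
    disjoint        : ∀ {q} → Lower q → Upper q → ⊥
    located         : ∀ {q r} → q ℚ.< r → Lower q ⊎ Upper r

open ℝ

infix 4 _<ᴿ_ _≤ᴿ_

_<ᴿ_ : ℝ → ℝ → Set
x <ᴿ y = ∃[ q ] (Upper x q × Lower y q)

_≤ᴿ_ : ℝ → ℝ → Set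
x ≤ᴿ y = ¬ (y <ᴿ x)

private
  [q+1]-1≡q : ∀ q → (q ℚ.+ 1ℚ) ℚ.- 1ℚ ≡ q
  [q+1]-1≡q q = begin
    (q ℚ.+ 1ℚ) ℚ.- 1ℚ  ≡⟨ ℚ.+-assoc q 1ℚ (ℚ.- 1ℚ) ⟩
    q ℚ.+ (1ℚ ℚ.- 1ℚ)  ≡⟨ cong (q ℚ.+_) (ℚ.+-inverseʳ 1ℚ) ⟩
    q ℚ.+ ℚ.0ℚ         ≡⟨ ℚ.+-identityʳ q ⟩
    q                  ∎
    where open ≡-Reasoning

  [q-1]+1≡q : ∀ q → (q ℚ.- 1ℚ) ℚ.+ 1ℚ ≡ q
  [q-1]+1≡q q = begin
    (q ℚ.- 1ℚ) ℚ.+ 1ℚ         ≡⟨ ℚ.+-assoc q (ℚ.- 1ℚ) 1ℚ ⟩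
    q ℚ.+ ((ℚ.- 1ℚ) ℚ.+ 1ℚ)   ≡⟨ cong (q ℚ.+_) (ℚ.+-inverseˡ 1ℚ) ⟩
    q ℚ.+ ℚ.0ℚ                ≡⟨ ℚ.+-identityʳ q ⟩
    q                         ∎
    where open ≡-Reasoning

  shift-< : ∀ {q r} → q ℚ.< r → (q ℚ.- 1ℚ) ℚ.< (r ℚ.- 1ℚ)
  shift-< = ℚ.+-monoˡ-< (ℚ.- 1ℚ)

  shift-<⁻ : ∀ {q r} → (q ℚ.- 1ℚ) ℚ.< r → q ℚ.< (r ℚ.+ 1ℚ)
  shift-<⁻ {q} {r} lt =
    subst (ℚ._< (r ℚ.+ 1ℚ)) ([q-1]+1≡q q) (ℚ.+-monoˡ-< 1ℚ lt)

  shift-<⁻′ : ∀ {q r} → q ℚ.< (r ℚ.- 1ℚ) → (q ℚ.+ 1ℚ) ℚ.< r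
  shift-<⁻′ {q} {r} lt =
    subst ((q ℚ.+ 1ℚ) ℚ.<_) ([q-1]+1≡q r) (ℚ.+-monoˡ-< 1ℚ lt)

infixl 6 _+1

_+1 : ℝ → ℝ
Lower (x +1) q = Lower x (q ℚ.- 1ℚ)
Upper (x +1) q = Upper x (q ℚ.- 1ℚ)
lower-inhabited (x +1) with q , l ← lower-inhabited x =
  q ℚ.+ 1ℚ , subst (Lower x) (sym ([q+1]-1≡q q)) l
upper-inhabited (x +1) with q , u ← upper-inhabited x =
  q ℚ.+ 1ℚ , subst (Upper x) (sym ([q+1]-1≡q q)) u
lower-downward (x +1) lt = lower-downward x (shift-< lt)
upper-upward (x +1) lt = upper-upward x (shift-< lt)
lower-rounded (x +1) l with r , lt , l′ ← lower-rounded x l =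
  r ℚ.+ 1ℚ , shift-<⁻ lt , subst (Lower x) (sym ([q+1]-1≡q r)) l′
upper-rounded (x +1) u with q , lt , u′ ← upper-rounded x u =
  q ℚ.+ 1ℚ , shift-<⁻′ lt , subst (Upper x) (sym ([q+1]-1≡q q)) u′
disjoint (x +1) = disjoint x
located (x +1) lt = located x (shift-< lt)

-- The square with lower left corner (left , bottom) is
-- [left , left + 1] × [bottom , bottom + 1].

record UnitSquare : Set₁ where
  field
    left bottom : ℝ

  right top : ℝ
  right = left +1
  top   = bottom +1

open UnitSquare

Point : Set₁
Point = ℝ × ℝ

Interior : UnitSquare → Point → Set
Interior s (x , y) = (left s <ᴿ x × x <ᴿ right s) × (bottom s <ᴿ y × y <ᴿ top s)

Layout : ℕ → Set₁
Layout n = Fin n → UnitSquare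

DisjointInteriors : ∀ {n} → Layout n → Set₁
DisjointInteriors S =
  ∀ v w → v ≢ w → ∀ p → ¬ (Interior (S v) p × Interior (S w) p)

MeetsInteriorAt : ℝ → UnitSquare → Set₁
MeetsInteriorAt y₀ s = ∃[ x ] Interior s (x , y₀)

-- On a horizontal line meeting both squares, the part between s and t is the
-- closed segment from the right side of one to the left side of the other.

BetweenX : UnitSquare → UnitSquare → ℝ → Set
BetweenX s t x = (right s ≤ᴿ x × x ≤ᴿ left t) ⊎ (right t ≤ᴿ x × x ≤ᴿ left s)

HorizontalBand : ∀ {n} → Layout n → Fin n → Fin n → Set₁
HorizontalBand S v w =
  ∃[ a ] ∃[ b ] (a <ᴿ b × (∀ y₀ → a <ᴿ y₀ → y₀ <ᴿ b →
    MeetsInteriorAt y₀ (S v) × MeetsInteriorAt y₀ (S w) ×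
    (∀ x → BetweenX (S v) (S w) x →
     ∀ u → u ≢ v → u ≢ w → ¬ Interior (S u) (x , y₀))))

swapAxes : UnitSquare → UnitSquare
swapAxes s = record { left = bottom s ; bottom = left s }

VerticalBand : ∀ {n} → Layout n → Fin n → Fin n → Set₁
VerticalBand S = HorizontalBand (swapAxes ∘ S)

record Graph (n : ℕ) : Set₁ where
  field
    Adj    : Fin n → Fin n → Set
    adj?   : Decidable Adj
    symm   : Symmetric Adj
    irrefl : Irreflexive _≡_ Adj

open Graph

-- Adjacency is decidable, so the edges can be listed; each unordered edge
-- {i , j} occurs once, as the pair with i < j.

edges : ∀ {n} → Graph n → List (Fin n × Fin n)
edges {n} G =
  filter (λ (i , j) → (i Fin.<? j) ×-dec adj? G i j)
         (cartesianProduct (allFin n) (allFin n))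

∣E_∣ : ∀ {n} → Graph n → ℕ
∣E G ∣ = length (edges G)

Bipartite : ∀ {n} → Graph n → Set
Bipartite {n} G =
  Σ (Fin n → Bool) λ colour → ∀ v w → Adj G v w → colour v ≢ colour w

Represents : ∀ {n} → Layout n → Graph n → Set₁
Represents S G =
  DisjointInteriors S ×
  (∀ v w → v ≢ w → Adj G v w ⇔ (HorizontalBand S v w ⊎ VerticalBand S v w))

IsURVG : ∀ {n} → Graph n → Set₁
IsURVG {n} G = Σ (Layout n) λ S → Represents S G

-- ⌈√ n ⌉ is the least k with n ≤ k * k; see ⌈√⌉-upper and ⌈√⌉-least.
-- By ⌈√n⌉≤n, truncated subtraction in 4 * n ∸ 2 * ⌈√ n ⌉ never truncates.

⌈√_⌉ : ℕ → ℕ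
⌈√ zero ⌉  = zero
⌈√ suc n ⌉ with suc n ℕ.≤? ⌈√ n ⌉ ℕ.* ⌈√ n ⌉
... | yes _ = ⌈√ n ⌉
... | no  _ = suc ⌈√ n ⌉

⌈√⌉-upper : ∀ n → n ℕ.≤ ⌈√ n ⌉ ℕ.* ⌈√ n ⌉
⌈√⌉-upper zero = z≤n
⌈√⌉-upper (suc n) with suc n ℕ.≤? ⌈√ n ⌉ ℕ.* ⌈√ n ⌉
... | yes p = p
... | no  _ = s≤s (ℕ.≤-trans (⌈√⌉-upper n)
    (ℕ.≤-trans (ℕ.*-monoʳ-≤ ⌈√ n ⌉ (ℕ.n≤1+n ⌈√ n ⌉)) (ℕ.m≤n+m _ ⌈√ n ⌉)))

⌈√⌉-least : ∀ n k → n ℕ.≤ k ℕ.* k → ⌈√ n ⌉ ℕ.≤ k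
⌈√⌉-least zero k _ = z≤n
⌈√⌉-least (suc n) k p with suc n ℕ.≤? ⌈√ n ⌉ ℕ.* ⌈√ n ⌉
... | yes _ = ⌈√⌉-least n k (ℕ.≤-trans (ℕ.n≤1+n n) p)
... | no ¬q = ℕ.≤∧≢⇒< (⌈√⌉-least n k (ℕ.≤-trans (ℕ.n≤1+n n) p))
    (λ e → ¬q (subst (λ j → suc n ℕ.≤ j ℕ.* j) (sym e) p))

⌈√n⌉≤n : ∀ n → ⌈√ n ⌉ ℕ.≤ n
⌈√n⌉≤n zero    = z≤n
⌈√n⌉≤n (suc n) = ⌈√⌉-least (suc n) (suc n) (ℕ.m≤m*n (suc n) (suc n))

{-# OPTIONS --safe #-}
module Submission where

open import Defs
open import Data.Nat using (ℕ; _+_; _*_; _∸_; _≤_)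
open import Data.Bool using (Bool; true; false; T; if_then_else_)
import Data.Bool.Properties as Bool
open import Data.Empty using (⊥; ⊥-elim)
open import Data.Fin as Fin using (Fin; fromℕ<; combine)
import Data.Fin.Properties as Fin
open import Data.Integer as ℤ using (+_)
import Data.Integer.Properties as ℤ
open import Data.List using (List; []; _∷_; _++_; length; map; allFin; cartesianProduct)
import Data.List.Membership.DecPropositional as DecMembership
open import Data.List.Membership.Propositional using (_∈_)
open import Data.List.Membership.Propositional.Properties
  using (∈-++⁺ˡ; ∈-++⁺ʳ; ∈-++⁻; ∈-map⁺; ∈-∃++; ∈-filter⁻; ∈-allFin)
open import Data.List.Properties using (length-++; length-map; length-tabulate)
open import Data.List.Relation.Binary.Permutation.Propositional using (↭-sym; ↭⇒↭ₛ)
open import Data.List.Relation.Binary.Permutation.Propositional.Properties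
  using (∈-resp-↭; ↭-length)
import Data.List.Relation.Binary.Permutation.Setoid.Properties as Permutation
open import Data.List.Relation.Unary.All as All using (All; []; _∷_)
open import Data.List.Relation.Unary.All.Properties using (++⁻ʳ)
open import Data.List.Relation.Unary.AllPairs as AllPairs using (AllPairs; []; _∷_)
open import Data.List.Relation.Unary.Any using (here; there)
open import Data.List.Relation.Unary.Sorted.TotalOrder.Properties using (Sorted⇒AllPairs)
open import Data.List.Relation.Unary.Unique.Propositional using (Unique)
open import Data.List.Relation.Unary.Unique.Propositional.Properties
  using (allFin⁺; cartesianProduct⁺; filter⁺)
import Data.List.Sort as Sort
open import Data.Maybe using (Maybe; just; nothing)
import Data.Maybe.Properties as Maybe
open import Data.Nat as ℕ using (zero; suc; _<_; z≤n; s≤s; _≤?_; _<?_)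
open import Data.Nat.Properties
open import Data.Nat.Tactic.RingSolver using (solve-∀)
open import Data.Product using (∃-syntax; _×_; _,_; proj₁; proj₂; swap)
open import Data.Product.Properties using (≡-dec)
open import Data.Rational as ℚ using (ℚ; 0ℚ; 1ℚ; mkℚ; toℚᵘ)
import Data.Rational.Properties as ℚ
open import Data.Rational.Unnormalised as ℚᵘ using (mkℚᵘ)
import Data.Rational.Unnormalised.Properties as ℚᵘ
open import Data.Sum using (_⊎_; inj₁; inj₂; map₂; [_,_]; [_,_]′)
open import Data.Unit using (⊤; tt)
open import Effect.Monad using (RawMonad)
open import Function.Base using (_∘_; id)
open import Function.Bundles using (_⇔_; module Equivalence)
open import Relation.Binary.Bundles using (DecTotalOrder)
import Relation.Binary.Construct.On as On
open import Relation.Binary.Definitions using (DecidableEquality; tri<; tri≈; tri>)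
open import Relation.Binary.PropositionalEquality hiding ([_])
open import Relation.Nullary using (¬_; Dec; yes; no; does; contradiction)
open import Relation.Nullary.Decidable
  using (_×-dec_; _⊎-dec_; toWitness; isYes≗does; dec-true; dec-false;
         decidable-stable; ¬¬-excluded-middle)
open import Relation.Nullary.Negation using (¬¬-Monad)

open ℝ
open UnitSquare

-- In each direction, sweep a line across the squares.  The squares it meets form
-- a stack whose consecutive members see each other, and every edge occurs as a
-- consecutive pair of some stack.  At one event, suppose k squares leave and m
-- enter between two consecutive survivors.  Colours alternate along the stacks
-- before and after, so k + m is even; if it is not 0, the m + 1 new pairs satisfy
-- 2(m + 1) ≤ 3m + k.  In the gaps at the two ends of the stack this inequality has
-- slack, worth 1 for each change of the first or last square.  As every square
-- enters and leaves once, a direction with E edges, F changes of the first square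
-- and L of the last satisfies 2E + F + L ≤ 4n.
--
-- The sides have equal length, so the first square of the stack changes during the
-- life of each square.  Labelling a square by the numbers of such changes before it
-- in both directions is injective because interiors are disjoint; thus n ≤ F F′,
-- whence F + F′ + 1 ≥ 2⌈√n⌉, and likewise for L.  Summing both directions gives
-- |E(G)| ≤ 4n − 2⌈√n⌉ + 1.
--
-- Only finitely many real numbers occur, and the conclusion is decidable; so all
-- their comparisons may be taken as decided and the reals replaced by ranks in ℕ.

-- One event of the sweep

module _ {A : Set} where

  link : Maybe A → A → List (A × A)
  link nothing  x = []
  link (just p) x = (p , x) ∷ []

  -- The `Maybe` argument is the last member met so far, so that inductions along the list can
  -- resume in the middle of a stack; `last` carries the same accumulator.
  consecutive : (A → Bool) → Maybe A → List A → List (A × A)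
  consecutive P p []       = []
  consecutive P p (x ∷ xs) =
    if P x then link p x ++ consecutive P (just x) xs else consecutive P p xs

  first : (A → Bool) → List A → Maybe A
  first P []       = nothing
  first P (x ∷ xs) = if P x then just x else first P xs

  last : (A → Bool) → Maybe A → List A → Maybe A
  last P p []       = p
  last P p (x ∷ xs) = if P x then last P (just x) xs else last P p xs

  present : Maybe A → ℕ
  present nothing  = 0
  present (just _) = 1

  present≤1 : ∀ (p : Maybe A) → present p ≤ 1
  present≤1 nothing  = z≤n
  present≤1 (just _) = ≤-refl

  last-just : ∀ (P : A → Bool) p xs → present (last P (just p) xs) ≡ 1
  last-just P p [] = refl
  last-just P p (x ∷ xs) with P x
  ... | true  = last-just P x xs
  ... | false = last-just P p xs

  ifGap : ℕ → List (A × A) → List (A × A)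
  ifGap zero    zs = []
  ifGap (suc _) zs = zs

  module Event (P Q : A → Bool) where

    -- g is the number of starts and ends since the last survivor: if g = 0, the next
    -- survivor forms a pair that was already consecutive.
    fresh : ℕ → Maybe A → List A → List (A × A)
    fresh g q []       = []
    fresh g q (x ∷ xs) with P x | Q x
    ... | true  | true  = ifGap g (link q x) ++ fresh 0 (just x) xs
    ... | true  | false = fresh (suc g) q xs
    ... | false | true  = link q x ++ fresh (suc g) (just x) xs
    ... | false | false = fresh g q xs

    -- An end is charged 1 and a start 3, so a square is charged 4 over its whole life: this is the
    -- source of `4 * n`.
    cost : Bool → Bool → ℕ
    cost true  false = 1
    cost false true  = 3
    cost _     _     = 0

    costs : List A → ℕ
    costs []       = 0
    costs (x ∷ xs) = cost (P x) (Q x) + costs xs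

    -- The accumulators `p` and `q` agree as long as nothing has changed since the last survivor, so
    -- a pair closed by a survivor with `g` equal to 0 is an old one.
    consecutive⇒old⊎fresh : ∀ g p q xs {z} → (g ≡ 0 → p ≡ q) →
      z ∈ consecutive Q q xs → z ∈ consecutive P p xs ⊎ z ∈ fresh g q xs
    consecutive⇒old⊎fresh g p q (x ∷ xs) same z∈ with P x | Q x
    consecutive⇒old⊎fresh g p q (x ∷ xs) same z∈ | true | true with ∈-++⁻ (link q x) z∈
    consecutive⇒old⊎fresh zero p q (x ∷ xs) same z∈ | true | true | inj₁ z∈link
      with refl ← same refl = inj₁ (∈-++⁺ˡ z∈link)
    consecutive⇒old⊎fresh (suc g) p q (x ∷ xs) same z∈ | true | true | inj₁ z∈link =
      inj₂ (∈-++⁺ˡ z∈link)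
    ... | inj₂ z∈rest with consecutive⇒old⊎fresh 0 (just x) (just x) xs (λ _ → refl) z∈rest
    ...   | inj₁ old = inj₁ (∈-++⁺ʳ (link p x) old)
    ...   | inj₂ new = inj₂ (∈-++⁺ʳ (ifGap g (link q x)) new)
    consecutive⇒old⊎fresh g p q (x ∷ xs) same z∈ | true | false
      with consecutive⇒old⊎fresh (suc g) (just x) q xs (λ ()) z∈
    ... | inj₁ old = inj₁ (∈-++⁺ʳ (link p x) old)
    ... | inj₂ new = inj₂ new
    consecutive⇒old⊎fresh g p q (x ∷ xs) same z∈ | false | true with ∈-++⁻ (link q x) z∈
    ... | inj₁ z∈link = inj₂ (∈-++⁺ˡ z∈link)
    ... | inj₂ z∈rest with consecutive⇒old⊎fresh (suc g) p (just x) xs (λ ()) z∈rest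
    ...   | inj₁ old = inj₁ old
    ...   | inj₂ new = inj₂ (∈-++⁺ʳ (link q x) new)
    consecutive⇒old⊎fresh g p q (x ∷ xs) same z∈ | false | false =
      consecutive⇒old⊎fresh g p q xs same z∈

  module Change (_≟_ : DecidableEquality A) where

    private
      _≟ₘ_ = Maybe.≡-dec _≟_

    change : Maybe A → Maybe A → ℕ
    change p q with p ≟ₘ q
    ... | yes _ = 0
    ... | no  _ = 1

    change-refl : ∀ p → change p p ≡ 0
    change-refl p with p ≟ₘ p
    ... | yes _  = refl
    ... | no p≢p = contradiction refl p≢p

    change≤1 : ∀ p q → change p q ≤ 1
    change≤1 p q with p ≟ₘ q
    ... | yes _ = z≤n
    ... | no  _ = ≤-refl

    change≡0⇒≡ : ∀ p q → change p q ≡ 0 → p ≡ q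
    change≡0⇒≡ p q e with yes p≡q ← p ≟ₘ q = p≡q

    module EventBound (P Q : A → Bool) (c : A → Bool) where
      open Event P Q

      Bichromatic : A × A → Set
      Bichromatic (x , y) = c x ≢ c y

      -- What is kept about the last old member `p` and the last new member `q` when `g` starts and
      -- ends have been met since a survivor. After exactly one of them, `p` and `q` are consecutive
      -- in one of the two stacks, hence of different colours.
      Gap : ℕ → A → A → Set
      Gap 0 p q = p ≡ q
      Gap 1 p q = c p ≢ c q
      Gap _ p q = ⊤

      three-colours : ∀ {a b d : Bool} → a ≢ b → b ≢ d → a ≢ d → ⊥
      three-colours {a} {b} {d} a≢b b≢d a≢d =
        a≢d (trans (Bool.¬-not a≢b) (sym (Bool.¬-not (≢-sym b≢d))))

      double-suc : ∀ a b → 2 * suc a + b ≡ 2 + (2 * a + b)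
      double-suc = solve-∀

      -- Here `g` serves as credit. A start is charged 3, spends 2 on its new pair and saves 1; an
      -- end saves 1. The next survivor spends 2 on the pair that it closes, and at the end of the
      -- list 1 pays for a change of the last square.
      fresh-bound : ∀ g p q xs → Gap g p q →
        All Bichromatic (consecutive P (just p) xs) →
        All Bichromatic (consecutive Q (just q) xs) →
        2 * length (fresh g (just q) xs) + change (last P (just p) xs) (last Q (just q) xs)
          ≤ costs xs + g
      fresh-bound 0 p q [] refl _ _ = ≤-reflexive (change-refl (just p))
      fresh-bound (suc g) p q [] gap _ _ = ≤-trans (change≤1 (just p) (just q)) (s≤s z≤n)
      fresh-bound g p q (x ∷ xs) gap hP hQ with P x | Q x
      fresh-bound 0 p q (x ∷ xs) gap (_ ∷ hP) (_ ∷ hQ) | true | true =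
        fresh-bound 0 x x xs refl hP hQ
      -- Credit 1 would not suffice, but the case is void: `x` differs in colour from `p` by the old
      -- stack and from `q` by the new one, while `p` and `q` differ from each other.
      fresh-bound 1 p q (x ∷ xs) gap (px ∷ hP) (qx ∷ hQ) | true | true =
        ⊥-elim (three-colours gap qx px)
      fresh-bound (suc (suc g)) p q (x ∷ xs) gap (_ ∷ hP) (_ ∷ hQ) | true | true = begin
        2 * suc (length f) + d                    ≡⟨ double-suc (length f) d ⟩
        2 + (2 * length f + d)                    ≤⟨ +-monoʳ-≤ 2 (fresh-bound 0 x x xs refl hP hQ) ⟩
        2 + (costs xs + 0)                        ≤⟨ m≤m+n _ g ⟩
        2 + (costs xs + 0) + g                    ≡⟨ lemma′ (costs xs) g ⟩
        costs xs + suc (suc g)                    ∎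
        where
        open ≤-Reasoning
        f = fresh 0 (just x) xs
        d = change (last P (just x) xs) (last Q (just x) xs)
        lemma′ : ∀ a b → 2 + (a + 0) + b ≡ a + suc (suc b)
        lemma′ = solve-∀
      fresh-bound g p q (x ∷ xs) gap (px ∷ hP) hQ | true | false =
        ≤-trans (fresh-bound (suc g) x q xs (widen g gap) hP hQ) (≤-reflexive (+-suc (costs xs) g))
        where
        widen : ∀ g → Gap g p q → Gap (suc g) x q
        widen zero refl = ≢-sym px
        widen (suc g) _ = tt
      fresh-bound g p q (x ∷ xs) gap hP (qx ∷ hQ) | false | true = begin
        2 * suc (length f) + d                    ≡⟨ double-suc (length f) d ⟩
        2 + (2 * length f + d)
          ≤⟨ +-monoʳ-≤ 2 (fresh-bound (suc g) p x xs (widen g gap) hP hQ) ⟩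
        2 + (costs xs + suc g)                    ≡⟨ lemma′ (costs xs) g ⟩
        3 + costs xs + g                          ∎
        where
        open ≤-Reasoning
        f = fresh (suc g) (just x) xs
        d = change (last P (just p) xs) (last Q (just x) xs)
        lemma′ : ∀ a b → 2 + (a + suc b) ≡ 3 + a + b
        lemma′ = solve-∀
        widen : ∀ g → Gap g p q → Gap (suc g) p x
        widen zero refl = qx
        widen (suc g) _ = tt
      fresh-bound g p q (x ∷ xs) gap hP hQ | false | false = fresh-bound g p q xs gap hP hQ

      open ≤-Reasoning

      -- Nothing survived below, and a start has already been met.
      fresh-bound-started : ∀ g p q xs →
        All Bichromatic (consecutive P p xs) →
        All Bichromatic (consecutive Q (just q) xs) →
        2 * length (fresh (suc g) (just q) xs) + change (last P p xs) (last Q (just q) xs)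
          ≤ costs xs + suc g + present (last P p xs)
      fresh-bound-started g p q [] _ _ = begin
        change p (just q)    ≤⟨ change≤1 p (just q) ⟩
        1                    ≤⟨ s≤s z≤n ⟩
        suc g + present p    ∎
      fresh-bound-started g p q (x ∷ xs) hP hQ with P x | Q x
      fresh-bound-started g p q (x ∷ xs) hP (_ ∷ hQ) | true | true = begin
        2 * suc (length f) + d      ≡⟨ double-suc (length f) d ⟩
        2 + (2 * length f + d)
          ≤⟨ +-monoʳ-≤ 2 (fresh-bound 0 x x xs refl (++⁻ʳ (link p x) hP) hQ) ⟩
        2 + (costs xs + 0)          ≤⟨ m≤m+n _ g ⟩
        2 + (costs xs + 0) + g      ≡⟨ lemma′ (costs xs) g ⟩
        -- The pair closed by the first survivor costs 2, and the credit is only known to be at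
        -- least 1. The missing unit is `present`, which equals 1 because `x` was in the old stack.
        costs xs + suc g + 1        ≡⟨ cong (λ e → costs xs + suc g + e) (last-just P x xs) ⟨
        costs xs + suc g + present (last P (just x) xs) ∎
        where
        f = fresh 0 (just x) xs
        d = change (last P (just x) xs) (last Q (just x) xs)
        lemma′ : ∀ a b → 2 + (a + 0) + b ≡ a + suc b + 1
        lemma′ = solve-∀
      fresh-bound-started g p q (x ∷ xs) hP hQ | true | false = begin
        2 * length f + d
          ≤⟨ fresh-bound-started (suc g) (just x) q xs (++⁻ʳ (link p x) hP) hQ ⟩
        costs xs + suc (suc g) + e      ≡⟨ cong (_+ e) (+-suc (costs xs) (suc g)) ⟩
        suc (costs xs + suc g) + e      ∎
        where
        f = fresh (2 + g) (just q) xs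
        d = change (last P (just x) xs) (last Q (just q) xs)
        e = present (last P (just x) xs)
      fresh-bound-started g p q (x ∷ xs) hP (_ ∷ hQ) | false | true = begin
        2 * suc (length f) + d             ≡⟨ double-suc (length f) d ⟩
        2 + (2 * length f + d)
          ≤⟨ +-monoʳ-≤ 2 (fresh-bound-started (suc g) p x xs hP hQ) ⟩
        2 + (costs xs + suc (suc g) + e)   ≡⟨ lemma′ (costs xs) g e ⟩
        3 + costs xs + suc g + e           ∎
        where
        f = fresh (2 + g) (just x) xs
        d = change (last P p xs) (last Q (just x) xs)
        e = present (last P p xs)
        lemma′ : ∀ a b d → 2 + (a + suc (suc b) + d) ≡ 3 + a + suc b + d
        lemma′ = solve-∀
      fresh-bound-started g p q (x ∷ xs) hP hQ | false | false =
        fresh-bound-started g p q xs hP hQ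

      -- Nothing survived below, and only ends have been met.
      fresh-bound-ended : ∀ g p xs →
        All Bichromatic (consecutive P (just p) xs) →
        All Bichromatic (consecutive Q nothing xs) →
        2 * length (fresh (suc g) nothing xs)
          + (change (last P (just p) xs) (last Q nothing xs) + present (last Q nothing xs))
          ≤ costs xs + suc g
      fresh-bound-ended g p [] _ _ = s≤s z≤n
      fresh-bound-ended g p (x ∷ xs) hP hQ with P x | Q x
      fresh-bound-ended g p (x ∷ xs) (_ ∷ hP) hQ | true | true = begin
        2 * length f + (d + e)    ≡⟨ cong (λ e → 2 * length f + (d + e)) (last-just Q x xs) ⟩
        2 * length f + (d + 1)    ≡⟨ +-assoc (2 * length f) d 1 ⟨
        2 * length f + d + 1      ≤⟨ +-monoˡ-≤ 1 (fresh-bound 0 x x xs refl hP hQ) ⟩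
        costs xs + 0 + 1          ≡⟨ cong (_+ 1) (+-identityʳ _) ⟩
        costs xs + 1              ≤⟨ +-monoʳ-≤ (costs xs) (s≤s z≤n) ⟩
        costs xs + suc g          ∎
        where
        f = fresh 0 (just x) xs
        d = change (last P (just x) xs) (last Q (just x) xs)
        e = present (last Q (just x) xs)
      fresh-bound-ended g p (x ∷ xs) (_ ∷ hP) hQ | true | false =
        ≤-trans (fresh-bound-ended (suc g) x xs hP hQ) (≤-reflexive (+-suc (costs xs) (suc g)))
      fresh-bound-ended g p (x ∷ xs) hP hQ | false | true = begin
        2 * length f + (d + e)       ≡⟨ cong (λ e → 2 * length f + (d + e)) (last-just Q x xs) ⟩
        2 * length f + (d + 1)       ≡⟨ +-assoc (2 * length f) d 1 ⟨
        2 * length f + d + 1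
          ≤⟨ +-monoˡ-≤ 1 (fresh-bound-started (suc g) (just p) x xs hP hQ) ⟩
        costs xs + suc (suc g) + present (last P (just p) xs) + 1
          ≡⟨ cong (λ e → costs xs + suc (suc g) + e + 1) (last-just P p xs) ⟩
        costs xs + suc (suc g) + 1 + 1  ≡⟨ lemma (costs xs) g ⟩
        3 + costs xs + suc g         ∎
        where
        f = fresh (2 + g) (just x) xs
        d = change (last P (just p) xs) (last Q (just x) xs)
        e = present (last Q (just x) xs)
        lemma : ∀ a b → a + suc (suc b) + 1 + 1 ≡ 3 + a + suc b
        lemma = solve-∀
      fresh-bound-ended g p (x ∷ xs) hP hQ | false | false = fresh-bound-ended g p xs hP hQ

      -- The `present` terms hold one unit in reserve while the stack is not empty. It is spent, for
      -- instance, when a sole square ends: both the first and the last square change, but the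
      -- charge is only 1.
      event-bound : ∀ xs →
        All Bichromatic (consecutive P nothing xs) →
        All Bichromatic (consecutive Q nothing xs) →
        2 * length (fresh 0 nothing xs)
          + (change (first P xs) (first Q xs)
            + (change (last P nothing xs) (last Q nothing xs) + present (last Q nothing xs)))
          ≤ costs xs + present (last P nothing xs)
      event-bound [] _ _ = ≤-refl
      event-bound (x ∷ xs) hP hQ with P x | Q x
      ... | true | true = begin
        2 * length f + (b + (d + e))
          ≡⟨ cong₂ (λ b e → 2 * length f + (b + (d + e))) (change-refl (just x)) (last-just Q x xs) ⟩
        2 * length f + (d + 1)        ≡⟨ +-assoc (2 * length f) d 1 ⟨
        2 * length f + d + 1          ≤⟨ +-monoˡ-≤ 1 (fresh-bound 0 x x xs refl hP hQ) ⟩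
        costs xs + 0 + 1              ≡⟨ cong₂ _+_ (+-identityʳ _) (sym (last-just P x xs)) ⟩
        costs xs + present (last P (just x) xs) ∎
        where
        f = fresh 0 (just x) xs
        b = change (just x) (just x)
        d = change (last P (just x) xs) (last Q (just x) xs)
        e = present (last Q (just x) xs)
      ... | true | false = begin
        2 * length f + (b + e)        ≡⟨ lemma (2 * length f) b e ⟩
        b + (2 * length f + e)
          ≤⟨ +-mono-≤ (change≤1 (just x) (first Q xs)) (fresh-bound-ended 0 x xs hP hQ) ⟩
        -- The charge of the end `x` pays for the change of the first square; the credit with which
        -- `fresh-bound-ended` begins is the reserve of the old stack.
        1 + (costs xs + 1)            ≡⟨ cong (λ e → 1 + (costs xs + e)) (last-just P x xs) ⟨
        1 + costs xs + present (last P (just x) xs) ∎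
        where
        f = fresh 1 nothing xs
        b = change (just x) (first Q xs)
        e = change (last P (just x) xs) (last Q nothing xs) + present (last Q nothing xs)
        lemma : ∀ a b e → a + (b + e) ≡ b + (a + e)
        lemma = solve-∀
      ... | false | true = begin
        -- The 3 charged to the start `x` splits into 1 for the change of the first square, 1 for
        -- the new reserve and 1 for the credit with which `fresh-bound-started` begins.
        2 * length f + (change (first P xs) (just x) + (d + present (last Q (just x) xs)))
          ≤⟨ +-monoʳ-≤ (2 * length f) (+-mono-≤ (change≤1 (first P xs) (just x))
               (+-monoʳ-≤ d (present≤1 (last Q (just x) xs)))) ⟩
        2 * length f + (1 + (d + 1))  ≡⟨ lemma (2 * length f) d ⟩
        2 + (2 * length f + d)        ≤⟨ +-monoʳ-≤ 2 (fresh-bound-started 0 nothing x xs hP hQ) ⟩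
        2 + (costs xs + 1 + h)        ≡⟨ lemma′ (costs xs) h ⟩
        3 + costs xs + h              ∎
        where
        f = fresh 1 (just x) xs
        d = change (last P nothing xs) (last Q (just x) xs)
        h = present (last P nothing xs)
        lemma : ∀ a d → a + (1 + (d + 1)) ≡ 2 + (a + d)
        lemma = solve-∀
        lemma′ : ∀ a b → 2 + (a + 1 + b) ≡ 3 + a + b
        lemma′ = solve-∀
      ... | false | false = event-bound xs hP hQ

-- Sweeping unit intervals

module _ {A : Set} where

  first-just : ∀ (P : A → Bool) xs {x} → first P xs ≡ just x → P x ≡ true
  first-just P (y ∷ xs) eq with P y in Py
  first-just P (y ∷ xs) refl | true = Py
  ... | false = first-just P xs eq

  first-nothing : ∀ (P : A → Bool) {xs x} → first P xs ≡ nothing → x ∈ xs → P x ≡ false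
  first-nothing P {y ∷ xs} eq x∈ with P y in Py
  first-nothing P {y ∷ xs} eq (here refl) | false = Py
  first-nothing P {y ∷ xs} eq (there x∈)  | false = first-nothing P eq x∈

  last-source : ∀ (P : A → Bool) p xs {x} → last P p xs ≡ just x → p ≡ just x ⊎ P x ≡ true
  last-source P p [] eq = inj₁ eq
  last-source P p (y ∷ xs) eq with P y in Py
  ... | false = last-source P p xs eq
  ... | true with last-source P (just y) xs eq
  ...   | inj₁ refl = inj₂ Py
  ...   | inj₂ Px   = inj₂ Px

  last-nothing : ∀ (P : A → Bool) p {xs x} → last P p xs ≡ nothing → x ∈ xs → P x ≡ false
  last-nothing P p {y ∷ xs} eq x∈ with P y in Py
  last-nothing P p {y ∷ xs} eq x∈ | true
    with () ← trans (sym (last-just P y xs)) (cong present eq)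
  last-nothing P p {y ∷ xs} eq (here refl) | false = Py
  last-nothing P p {y ∷ xs} eq (there x∈)  | false = last-nothing P p eq x∈

  last-unchanged : ∀ (P : A → Bool) p xs → (∀ x → P x ≡ false) → last P p xs ≡ p
  last-unchanged P p []       _    = refl
  last-unchanged P p (x ∷ xs) none with P x | none x
  ... | false | _ = last-unchanged P p xs none

  consecutive-none : ∀ (P : A → Bool) p xs → (∀ x → P x ≡ false) → consecutive P p xs ≡ []
  consecutive-none P p []       _    = refl
  consecutive-none P p (x ∷ xs) none with P x | none x
  ... | false | _ = consecutive-none P p xs none

module Bars {A : Set} (_≟_ : DecidableEquality A) (l r : A → ℕ)
            (0<l : ∀ x → 0 < l x) (l<r : ∀ x → l x < r x) where

  open Change _≟_

  -- Half-open: time `k` stands for a sweep line just past rank `k`, so a bar that ends at `k` and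
  -- one that starts there are not alive together.
  Alive : ℕ → A → Set
  Alive k x = l x ≤ k × k < r x

  alive? : ∀ k x → Dec (Alive k x)
  alive? k x = (l x ≤? k) ×-dec (k <? r x)

  alive : ℕ → A → Bool
  alive k x = does (alive? k x)

  alive⁻ : ∀ k x → alive k x ≡ true → Alive k x
  alive⁻ k x eq =
    toWitness {a? = alive? k x} (subst T (sym (trans (isYes≗does (alive? k x)) eq)) tt)

  alive⁺ : ∀ k x → Alive k x → alive k x ≡ true
  alive⁺ k x = dec-true (alive? k x)

  dead⁻ : ∀ k x → alive k x ≡ false → ¬ Alive k x
  dead⁻ k x eq a with () ← trans (sym (alive⁺ k x a)) eq

  -- The sweep begins with an empty stack, so every consecutive pair is created by some event.
  none-alive-at-0 : ∀ x → alive 0 x ≡ false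
  none-alive-at-0 x = dec-false (alive? 0 x) (λ (l≤0 , _) → <⇒≱ (0<l x) l≤0)

  reached : ℕ → ℕ → ℕ
  reached k a = if does (a ≤? k) then 1 else 0

  reached-yes : ∀ {k a} → a ≤ k → reached k a ≡ 1
  reached-yes {k} {a} a≤k rewrite dec-true (a ≤? k) a≤k = refl

  reached-no : ∀ {k a} → ¬ a ≤ k → reached k a ≡ 0
  reached-no {k} {a} a≰k rewrite dec-false (a ≤? k) a≰k = refl

  reached≤1 : ∀ k a → reached k a ≤ 1
  reached≤1 k a with does (a ≤? k)
  ... | true  = ≤-refl
  ... | false = z≤n

  reached-mono : ∀ k a → reached k a ≤ reached (suc k) a
  reached-mono k a with does (a ≤? k) in eq
  ... | false = z≤n
  ... | true  = ≤-reflexive (sym (reached-yes (m≤n⇒m≤1+n a≤k)))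
    where
    a≤k : a ≤ k
    a≤k = ≤ᵇ⇒≤ a k (subst T (sym eq) tt)

  -- The cumulative charge in closed form: each event is compared with the increase of this total,
  -- which plainly never exceeds 4.
  paid : ℕ → A → ℕ
  paid k x = 3 * reached k (l x) + reached k (r x)

  totalPaid : ℕ → List A → ℕ
  totalPaid k []       = 0
  totalPaid k (x ∷ xs) = paid k x + totalPaid k xs

  totalPaid≤4* : ∀ k xs → totalPaid k xs ≤ 4 * length xs
  totalPaid≤4* k [] = z≤n
  totalPaid≤4* k (x ∷ xs) = begin
    paid k x + totalPaid k xs
      ≤⟨ +-mono-≤ (+-mono-≤ (*-monoʳ-≤ 3 (reached≤1 k (l x))) (reached≤1 k (r x)))
                   (totalPaid≤4* k xs) ⟩
    4 + 4 * length xs          ≡⟨ *-suc 4 (length xs) ⟨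
    4 * suc (length xs)        ∎
    where open ≤-Reasoning

  module Step (k : ℕ) = Event (alive k) (alive (suc k))

  cost≤paid : ∀ k x → Step.cost k (alive k x) (alive (suc k) x) + paid k x ≤ paid (suc k) x
  cost≤paid k x = go (alive k x) (alive (suc k) x) refl refl
    where
    paid-mono : paid k x ≤ paid (suc k) x
    paid-mono = +-mono-≤ (*-monoʳ-≤ 3 (reached-mono k (l x))) (reached-mono k (r x))

    go : ∀ p q → alive k x ≡ p → alive (suc k) x ≡ q →
         Step.cost k p q + paid k x ≤ paid (suc k) x
    go true  true  _ _ = paid-mono
    go false false _ _ = paid-mono
    go true false before after
      with l≤k , k<r ← alive⁻ k x before
      rewrite reached-yes l≤k | reached-yes (m≤n⇒m≤1+n l≤k)
            | reached-no {k} {r x} (<⇒≱ k<r)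
            | reached-yes {suc k} {r x}
                (≮⇒≥ (λ 1+k<r → dead⁻ (suc k) x after (m≤n⇒m≤1+n l≤k , 1+k<r))) = ≤-refl
    go false true before after
      with l≤1+k , 1+k<r ← alive⁻ (suc k) x after
      rewrite reached-no {k} {l x} (λ l≤k → dead⁻ k x before (l≤k , <-trans (n<1+n k) 1+k<r))
            | reached-yes l≤1+k = +-monoʳ-≤ 3 (reached-mono k (r x))

  costs≤totalPaid : ∀ k xs → Step.costs k xs + totalPaid k xs ≤ totalPaid (suc k) xs
  costs≤totalPaid k [] = z≤n
  costs≤totalPaid k (x ∷ xs) = begin
    (a + b) + (d + e)    ≡⟨ lemma a b d e ⟩
    (a + d) + (b + e)    ≤⟨ +-mono-≤ (cost≤paid k x) (costs≤totalPaid k xs) ⟩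
    paid (suc k) x + totalPaid (suc k) xs ∎
    where
    open ≤-Reasoning
    a = Step.cost k (alive k x) (alive (suc k) x)
    b = Step.costs k xs
    d = paid k x
    e = totalPaid k xs
    lemma : ∀ a b d e → (a + b) + (d + e) ≡ (a + d) + (b + e)
    lemma = solve-∀

  changes : (ℕ → Maybe A) → ℕ → ℕ
  changes f zero    = 0
  changes f (suc k) = change (f k) (f (suc k)) + changes f k

  changes-mono : ∀ f {j k} → j ≤ k → changes f j ≤ changes f k
  changes-mono f {j} {k} j≤k with m≤n⇒m<n∨m≡n j≤k
  ... | inj₂ refl = ≤-refl
  changes-mono f {j} {suc k} j≤k | inj₁ (s≤s j≤k′) =
    ≤-trans (changes-mono f j≤k′) (m≤n+m (changes f k) (change (f k) (f (suc k))))

  changes-≡ : ∀ f {j k} → j ≤ k → changes f k ≤ changes f j → f j ≡ f k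
  changes-≡ f {j} {k} j≤k le with m≤n⇒m<n∨m≡n j≤k
  ... | inj₂ refl = refl
  changes-≡ f {j} {suc k} j≤k le | inj₁ (s≤s j≤k′) =
    trans (changes-≡ f j≤k′ (≤-trans (m≤n+m _ _) le))
          (change≡0⇒≡ (f k) (f (suc k))
            (n≤0⇒n≡0 (+-cancelʳ-≤ (changes f k) _ 0 (≤-trans le (changes-mono f j≤k′)))))

  -- The properties shared by the first and the last square of the stack from which injectivity of
  -- the labels follows; both ends are thus treated at once.
  record Selector (xs : List A) (f : ℕ → Maybe A) : Set where
    field
      selected : ∀ {k x} → f k ≡ just x → Alive k x
      empty    : ∀ {k x} → f k ≡ nothing → x ∈ xs → ¬ Alive k x

  firstAlive lastAlive : List A → ℕ → Maybe A
  firstAlive xs k = first (alive k) xs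
  lastAlive  xs k = last (alive k) nothing xs

  firstAlive-selector : ∀ xs → Selector xs (firstAlive xs)
  firstAlive-selector xs = record
    { selected = λ {k} eq → alive⁻ k _ (first-just (alive k) xs eq)
    ; empty    = λ {k} eq x∈ → dead⁻ k _ (first-nothing (alive k) eq x∈)
    }

  lastAlive-selector : ∀ xs → Selector xs (lastAlive xs)
  lastAlive-selector xs = record
    { selected = λ {k} eq → alive⁻ k _ (source k eq)
    ; empty    = λ {k} eq x∈ → dead⁻ k _ (last-nothing (alive k) nothing eq x∈)
    }
    where
    source : ∀ k {x} → lastAlive xs k ≡ just x → alive k x ≡ true
    source k eq with last-source (alive k) nothing xs eq
    ... | inj₂ Px = Px

  module Unit (unit : ∀ x y → l x ≤ l y → r x ≤ r y) {xs : List A} where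

    -- The bar selected at l x starts no later than x, so it is gone at r x.
    change-during : ∀ {f x} → Selector xs f → x ∈ xs → changes f (l x) < changes f (r x)
    change-during {f} {x} sel x∈ = ≰⇒> λ le → go (f (l x)) refl (changes-≡ f (<⇒≤ (l<r x)) le)
      where
      open Selector sel
      go : ∀ m → f (l x) ≡ m → f (l x) ≡ f (r x) → ⊥
      go nothing  eq _    = empty eq x∈ (≤-refl , l<r x)
      go (just y) eq same = <⇒≱ (proj₂ (selected (trans (sym same) eq)))
                                (unit y x (proj₁ (selected eq)))

    -- If `x` ended before `y` started, the change during the life of `x` would make the count at
    -- `l y` strictly larger than at `l x`.
    same-changes⇒overlap : ∀ {f x y} → Selector xs f → x ∈ xs →
      changes f (l x) ≡ changes f (l y) → l y < r x
    same-changes⇒overlap {f} {x} {y} sel x∈ eq = ≰⇒> λ r≤l →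
      <⇒≱ (change-during sel x∈) (≤-trans (changes-mono f r≤l) (≤-reflexive (sym eq)))

  -- A pair may be listed several times; this is harmless, since the length only has to bound the
  -- number of edges from above.
  sightings : List A → ℕ → List (A × A)
  sightings xs zero    = []
  sightings xs (suc k) = Step.fresh k 0 nothing xs ++ sightings xs k

  consecutive⇒sighted : ∀ xs k {z} → z ∈ consecutive (alive k) nothing xs → z ∈ sightings xs k
  consecutive⇒sighted xs zero z∈
    with () ← subst (_ ∈_) (consecutive-none (alive 0) nothing xs none-alive-at-0) z∈
  consecutive⇒sighted xs (suc k) z∈
    with Step.consecutive⇒old⊎fresh k 0 nothing nothing xs (λ _ → refl) z∈
  ... | inj₁ old = ∈-++⁺ʳ (Step.fresh k 0 nothing xs) (consecutive⇒sighted xs k old)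
  ... | inj₂ new = ∈-++⁺ˡ new

  sightings-mono : ∀ xs {j k z} → j ≤ k → z ∈ sightings xs j → z ∈ sightings xs k
  sightings-mono xs {j} {k} j≤k z∈ with m≤n⇒m<n∨m≡n j≤k
  ... | inj₂ refl = z∈
  sightings-mono xs {j} {suc k} j≤k z∈ | inj₁ (s≤s j≤k′) =
    ∈-++⁺ʳ (Step.fresh k 0 nothing xs) (sightings-mono xs j≤k′ z∈)

  -- Sum of `event-bound` over the events. Keeping `present` in the statement makes it telescope:
  -- the reserve left by one event is the one available to the next.
  sightings-paid : (c : A → Bool) → ∀ xs →
    (∀ k → All (λ (x , y) → c x ≢ c y) (consecutive (alive k) nothing xs)) →
    ∀ k →
    2 * length (sightings xs k)
      + (changes (firstAlive xs) k + (changes (lastAlive xs) k + present (lastAlive xs k)))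
      ≤ totalPaid k xs
  sightings-paid c xs bichromatic zero
    rewrite last-unchanged (alive 0) nothing xs none-alive-at-0 = z≤n
  sightings-paid c xs bichromatic (suc k) = begin
    2 * length (f ++ s) + ((b′ + b) + ((t′ + t) + p′))
      ≡⟨ cong (λ m → 2 * m + ((b′ + b) + ((t′ + t) + p′))) (length-++ f) ⟩
    2 * (length f + length s) + ((b′ + b) + ((t′ + t) + p′))
      ≡⟨ lemma (length f) (length s) b′ b t′ t p′ ⟩
    (2 * length f + (b′ + (t′ + p′))) + (2 * length s + (b + t))
      ≤⟨ +-monoˡ-≤ _ (EventBound.event-bound (alive k) (alive (suc k)) c xs
                       (bichromatic k) (bichromatic (suc k))) ⟩
    (Step.costs k xs + p) + (2 * length s + (b + t))
      ≡⟨ lemma′ (Step.costs k xs) (length s) b t p ⟩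
    Step.costs k xs + (2 * length s + (b + (t + p)))
      ≤⟨ +-monoʳ-≤ (Step.costs k xs) (sightings-paid c xs bichromatic k) ⟩
    Step.costs k xs + totalPaid k xs
      ≤⟨ costs≤totalPaid k xs ⟩
    totalPaid (suc k) xs ∎
    where
    open ≤-Reasoning
    f  = Step.fresh k 0 nothing xs
    s  = sightings xs k
    b′ = change (firstAlive xs k) (firstAlive xs (suc k))
    b  = changes (firstAlive xs) k
    t′ = change (lastAlive xs k) (lastAlive xs (suc k))
    t  = changes (lastAlive xs) k
    p′ = present (lastAlive xs (suc k))
    p  = present (lastAlive xs k)
    lemma : ∀ f s b′ b t′ t p′ → 2 * (f + s) + ((b′ + b) + ((t′ + t) + p′))
      ≡ (2 * f + (b′ + (t′ + p′))) + (2 * s + (b + t))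
    lemma = solve-∀
    lemma′ : ∀ f s b t p → (f + p) + (2 * s + (b + t)) ≡ f + (2 * s + (b + (t + p)))
    lemma′ = solve-∀

  sightings-bound : (c : A → Bool) → ∀ xs →
    (∀ k → All (λ (x , y) → c x ≢ c y) (consecutive (alive k) nothing xs)) →
    ∀ k →
    2 * length (sightings xs k) + (changes (firstAlive xs) k + changes (lastAlive xs) k)
      ≤ 4 * length xs
  sightings-bound c xs bichromatic k = begin
    2 * length (sightings xs k) + (b + t)
      ≤⟨ +-monoʳ-≤ (2 * length (sightings xs k))
           (+-monoʳ-≤ b (m≤m+n t (present (lastAlive xs k)))) ⟩
    2 * length (sightings xs k) + (b + (t + present (lastAlive xs k)))
      ≤⟨ sightings-paid c xs bichromatic k ⟩
    totalPaid k xs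
      ≤⟨ totalPaid≤4* k xs ⟩
    4 * length xs ∎
    where
    open ≤-Reasoning
    b = changes (firstAlive xs) k
    t = changes (lastAlive xs) k

-- Consecutive members of a sorted stack

-- The order is weak because squares that no sweep line meets together may have equal left ends;
-- distinctness of the entries is recorded separately.
Below : {A : Set} → (A → ℕ) → A → A → Set
Below y u v = y u ≤ y v × u ≢ v

module _ {A : Set} (y : A → ℕ) (P : A → Bool) where

  record Neighbours (xs : List A) (i j : A) : Set where
    field
      alive-lower : P i ≡ true
      alive-upper : P j ≡ true
      below       : Below y i j
      unblocked   : ∀ {u} → u ∈ xs → P u ≡ true → y u ≤ y i ⊎ y j ≤ y u

  lower∈ : ∀ p xs {i j} → (i , j) ∈ consecutive P p xs → p ≡ just i ⊎ i ∈ xs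
  lower∈ p (x ∷ xs) z∈ with P x
  ... | false = map₂ there (lower∈ p xs z∈)
  lower∈ (just p) (x ∷ xs) (here refl) | true = inj₁ refl
  lower∈ (just p) (x ∷ xs) (there z∈)  | true with lower∈ (just x) xs z∈
  ... | inj₁ refl = inj₂ (here refl)
  ... | inj₂ i∈   = inj₂ (there i∈)
  lower∈ nothing (x ∷ xs) z∈ | true with lower∈ (just x) xs z∈
  ... | inj₁ refl = inj₂ (here refl)
  ... | inj₂ i∈   = inj₂ (there i∈)

  OntoAlive : Maybe A → List A → Set
  OntoAlive p xs = ∀ {q} → p ≡ just q → P q ≡ true × All (Below y q) xs

  consecutive⇒neighbours : ∀ p xs {i j} → AllPairs (Below y) xs → OntoAlive p xs →
    (i , j) ∈ consecutive P p xs → Neighbours xs i j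
  consecutive⇒neighbours p (x ∷ xs) {i} {j} (x≤xs ∷ sorted) onto z∈ with P x in Px
  ... | false = record
    { alive-lower = alive-lower ; alive-upper = alive-upper ; below = below
    ; unblocked = λ where
        (here refl) Pu → contradiction (trans (sym Px) Pu) λ ()
        (there u∈)  Pu → unblocked u∈ Pu
    }
    where
    tail-onto : OntoAlive p xs
    tail-onto eq = proj₁ (onto eq) , All.tail (proj₂ (onto eq))
    open Neighbours (consecutive⇒neighbours p xs sorted tail-onto z∈)
  ... | true with ∈-++⁻ (link p x) z∈
  consecutive⇒neighbours (just p) (x ∷ xs) (x≤xs ∷ sorted) onto z∈ | true | inj₁ (here refl)
    with Pp , p≤x ∷ _ ← onto refl = record
    { alive-lower = Pp ; alive-upper = Px ; below = p≤x
    ; unblocked = λ where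
        (here refl) _ → inj₂ ≤-refl
        (there u∈)  _ → inj₂ (proj₁ (All.lookup x≤xs u∈))
    }
  consecutive⇒neighbours p (x ∷ xs) {i} {j} (x≤xs ∷ sorted) onto z∈ | true | inj₂ z∈rest = record
    { alive-lower = alive-lower ; alive-upper = alive-upper ; below = below
    ; unblocked = λ where
        (here refl) _  → inj₁ x≤i
        (there u∈)  Pu → unblocked u∈ Pu
    }
    where
    tail-onto : OntoAlive (just x) xs
    tail-onto refl = Px , x≤xs
    open Neighbours (consecutive⇒neighbours (just x) xs sorted tail-onto z∈rest)
    x≤i : y x ≤ y i
    x≤i with lower∈ (just x) xs z∈rest
    ... | inj₁ refl = ≤-refl
    ... | inj₂ i∈   = proj₁ (All.lookup x≤xs i∈)

  module _ (injective : ∀ {u v} → P u ≡ true → P v ≡ true → y u ≡ y v → u ≡ v)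
           {i j : A} (Pi : P i ≡ true) (Pj : P j ≡ true)
           (unblocked : ∀ {u} → P u ≡ true → y u ≤ y i ⊎ y j ≤ y u) where

    -- A member met between `i` and `j` is squeezed by `unblocked` and the sorting to the value of
    -- `i` or of `j`, which injectivity on members excludes.
    neighbours⇒consecutive-from : ∀ xs → AllPairs (Below y) xs → All (Below y i) xs →
      j ∈ xs → (i , j) ∈ consecutive P (just i) xs
    neighbours⇒consecutive-from (x ∷ xs) (x≤xs ∷ sorted) ((i≤x , i≢x) ∷ i≤xs) j∈ with P x in Px
    neighbours⇒consecutive-from (x ∷ xs) (x≤xs ∷ sorted) ((i≤x , i≢x) ∷ i≤xs) (here refl) | false =
      contradiction (trans (sym Px) Pj) λ ()
    neighbours⇒consecutive-from (x ∷ xs) (x≤xs ∷ sorted) ((i≤x , i≢x) ∷ i≤xs) (there j∈) | false =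
      neighbours⇒consecutive-from xs sorted i≤xs j∈
    neighbours⇒consecutive-from (x ∷ xs) (x≤xs ∷ sorted) ((i≤x , i≢x) ∷ i≤xs) (here refl) | true =
      here refl
    neighbours⇒consecutive-from (x ∷ xs) (x≤xs ∷ sorted) ((i≤x , i≢x) ∷ i≤xs) (there j∈) | true
      with unblocked Px
    ... | inj₁ x≤i = contradiction (injective Pi Px (≤-antisym i≤x x≤i)) i≢x
    ... | inj₂ j≤x with x≤j , x≢j ← All.lookup x≤xs j∈ =
      contradiction (injective Px Pj (≤-antisym x≤j j≤x)) x≢j

    neighbours⇒consecutive : ∀ p xs → AllPairs (Below y) xs → y i < y j →
      i ∈ xs → j ∈ xs → (i , j) ∈ consecutive P p xs
    neighbours⇒consecutive p (x ∷ xs) (x≤xs ∷ sorted) i<j (here refl) (here refl) =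
      contradiction i<j (<-irrefl refl)
    neighbours⇒consecutive p (x ∷ xs) (x≤xs ∷ sorted) i<j (there i∈) (here refl) =
      contradiction (proj₁ (All.lookup x≤xs i∈)) (<⇒≱ i<j)
    neighbours⇒consecutive p (x ∷ xs) (x≤xs ∷ sorted) i<j (here refl) (there j∈)
      rewrite Pi = ∈-++⁺ʳ (link p x) (neighbours⇒consecutive-from xs sorted x≤xs j∈)
    neighbours⇒consecutive p (x ∷ xs) (x≤xs ∷ sorted) i<j (there i∈) (there j∈) with P x
    ... | true  = ∈-++⁺ʳ (link p x) (neighbours⇒consecutive (just x) xs sorted i<j i∈ j∈)
    ... | false = neighbours⇒consecutive p xs sorted i<j i∈ j∈

-- Real numbers

lower<upper : ∀ x {q r} → Lower x q → Upper x r → q ℚ.< r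
lower<upper x {q} {r} xq xr with ℚ.<-cmp q r
... | tri< q<r _ _  = q<r
... | tri≈ _ refl _ = ⊥-elim (disjoint x xq xr)
... | tri> _ _ r<q  = ⊥-elim (disjoint x xq (upper-upward x r<q xr))

<ᴿ-trans : ∀ {x y z} → x <ᴿ y → y <ᴿ z → x <ᴿ z
<ᴿ-trans {x} {y} {z} (q , xq , yq) (r , yr , zr) =
  r , upper-upward x (lower<upper y yq yr) xq , zr

<ᴿ-irrefl : ∀ {x} → ¬ x <ᴿ x
<ᴿ-irrefl {x} (q , u , l) = disjoint x l u

-- The constructive substitute for trichotomy: rounding the lower cut of `z` opens a rational gap,
-- and `y` is located with respect to it.
<ᴿ-cotrans : ∀ {x z} → x <ᴿ z → ∀ y → x <ᴿ y ⊎ y <ᴿ z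
<ᴿ-cotrans {x} {z} (q , xq , zq) y with r , q<r , zr ← lower-rounded z zq | located y q<r
... | inj₁ yq = inj₁ (q , xq , yq)
... | inj₂ yr = inj₂ (r , yr , zr)

≤-<ᴿ-trans : ∀ {x y z} → x ≤ᴿ y → y <ᴿ z → x <ᴿ z
≤-<ᴿ-trans {x} {y} {z} x≤y y<z with <ᴿ-cotrans {y} {z} y<z x
... | inj₁ y<x = contradiction y<x x≤y
... | inj₂ x<z = x<z

<-≤ᴿ-trans : ∀ {x y z} → x <ᴿ y → y ≤ᴿ z → x <ᴿ z
<-≤ᴿ-trans {x} {y} {z} x<y y≤z with <ᴿ-cotrans {x} {y} x<y z
... | inj₁ x<z = x<z
... | inj₂ z<y = contradiction z<y y≤z

<⇒≤ᴿ : ∀ {x y} → x <ᴿ y → x ≤ᴿ y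
<⇒≤ᴿ {x} {y} x<y y<x = <ᴿ-irrefl {x} (<ᴿ-trans {x} {y} {x} x<y y<x)

≤ᴿ-trans : ∀ {x y z} → x ≤ᴿ y → y ≤ᴿ z → x ≤ᴿ z
≤ᴿ-trans {x} {y} {z} x≤y y≤z z<x with <ᴿ-cotrans {z} {x} z<x y
... | inj₁ z<y = y≤z z<y
... | inj₂ y<x = x≤y y<x

fromℚ : ℚ → ℝ
fromℚ p = record
  { Lower = ℚ._< p
  ; Upper = p ℚ.<_
  ; lower-inhabited = p ℚ.- 1ℚ ,
      subst (p ℚ.- 1ℚ ℚ.<_) (ℚ.+-identityʳ p) (ℚ.+-monoʳ-< p (ℚ.negative⁻¹ (ℚ.- 1ℚ)))
  ; upper-inhabited = p ℚ.+ 1ℚ ,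
      subst (ℚ._< p ℚ.+ 1ℚ) (ℚ.+-identityʳ p) (ℚ.+-monoʳ-< p (ℚ.positive⁻¹ 1ℚ))
  ; lower-downward = ℚ.<-trans
  ; upper-upward = λ q<r p<q → ℚ.<-trans p<q q<r
  ; lower-rounded = λ q<p → let r , q<r , r<p = ℚ.<-dense q<p in r , q<r , r<p
  ; upper-rounded = λ p<r → let q , p<q , q<r = ℚ.<-dense p<r in q , q<r , p<q
  ; disjoint = λ q<p p<q → ℚ.<-asym q<p p<q
  ; located = located-at
  }
  where
  located-at : ∀ {q r} → q ℚ.< r → (q ℚ.< p) ⊎ (p ℚ.< r)
  located-at {q} q<r with q ℚ.<? p
  ... | yes q<p = inj₁ q<p
  ... | no  q≮p = inj₂ (ℚ.≤-<-trans (ℚ.≮⇒≥ q≮p) q<r)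

<ᴿ-dense : ∀ {x z} → x <ᴿ z → ∃[ y ] (x <ᴿ y × y <ᴿ z)
<ᴿ-dense {x} {z} (q , xq , zq)
  with p , p<q , xp ← upper-rounded x xq | r , q<r , zr ← lower-rounded z zq =
  fromℚ q , (p , xp , p<q) , (r , q<r , zr)

+1-cancel-< : ∀ {x y} → x +1 <ᴿ y +1 → x <ᴿ y
+1-cancel-< (q , u , l) = q ℚ.- 1ℚ , u , l

fromℕ : ℕ → ℚ
fromℕ zero    = 0ℚ
fromℕ (suc m) = fromℕ m ℚ.+ 1ℚ

toℚᵘ-fromℕ : ∀ m → toℚᵘ (fromℕ m) ℚᵘ.≃ mkℚᵘ (+ m) 0
toℚᵘ-fromℕ zero    = ℚᵘ.≃-refl
toℚᵘ-fromℕ (suc m) = ℚᵘ.≃-trans (ℚ.toℚᵘ-homo-+ (fromℕ m) 1ℚ)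
  (ℚᵘ.≃-trans (ℚᵘ.+-congˡ (toℚᵘ 1ℚ) (toℚᵘ-fromℕ m)) (ℚᵘ.*≡* (trans
    (cong (λ i → (i ℤ.+ + 1) ℤ.* + 1) (ℤ.*-identityʳ (+ m)))
    (cong (λ i → + i ℤ.* + 1) (+-comm m 1)))))

archimedean : ∀ q → ∃[ m ] q ℚ.≤ fromℕ m
archimedean q@(mkℚ i d _) = ℤ.∣ i ∣ ,
  ℚ.toℚᵘ-cancel-≤ (ℚᵘ.≤-trans bound (ℚᵘ.≤-reflexive (ℚᵘ.≃-sym (toℚᵘ-fromℕ ℤ.∣ i ∣))))
  where
  i≤∣i∣ : ∀ i → i ℤ.≤ + ℤ.∣ i ∣
  i≤∣i∣ (+ _)        = ℤ.≤-refl
  i≤∣i∣ ℤ.-[1+ _ ]   = ℤ.-≤+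

  bound : mkℚᵘ i d ℚᵘ.≤ mkℚᵘ (+ ℤ.∣ i ∣) 0
  bound = ℚᵘ.*≤* (begin
    i ℤ.* + 1              ≡⟨ ℤ.*-identityʳ i ⟩
    i                      ≤⟨ i≤∣i∣ i ⟩
    + ℤ.∣ i ∣              ≤⟨ ℤ.+≤+ (m≤m*n ℤ.∣ i ∣ (suc d)) ⟩
    + (ℤ.∣ i ∣ ℕ.* suc d)  ≡⟨ ℤ.pos-* ℤ.∣ i ∣ (suc d) ⟩
    + ℤ.∣ i ∣ ℤ.* + suc d  ∎)
    where open ℤ.≤-Reasoning

-- If no rational witnesses x < x + 1, then the lower cut of x is closed under
-- q ↦ q + 1, contradicting the archimedean property.
x<x+1 : ∀ x → ¬ ¬ x <ᴿ x +1
x<x+1 x x≮x+1 with q , xq ← lower-inhabited x | u , xu ← upper-inhabited x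
  with m , le ← archimedean (u ℚ.- q) =
  ℚ.<-irrefl refl (ℚ.<-≤-trans (lower<upper x (climb m) xu) u≤q+m)
  where
  next : ∀ {p} → Lower x p → Lower x (p ℚ.+ 1ℚ)
  next {p} xp with r , p<r , xr ← lower-rounded x xp
    with located x (ℚ.+-monoˡ-< 1ℚ p<r)
  ... | inj₁ xp+1 = xp+1
  ... | inj₂ xr+1 = contradiction
    (r ℚ.+ 1ℚ , xr+1 , subst (Lower x) (sym [r+1]-1≡r) xr) x≮x+1
    where
    [r+1]-1≡r : (r ℚ.+ 1ℚ) ℚ.- 1ℚ ≡ r
    [r+1]-1≡r = trans (ℚ.+-assoc r 1ℚ (ℚ.- 1ℚ)) (ℚ.+-identityʳ r)

  climb : ∀ m → Lower x (q ℚ.+ fromℕ m)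
  climb zero    = subst (Lower x) (sym (ℚ.+-identityʳ q)) xq
  climb (suc m) = subst (Lower x) (ℚ.+-assoc q (fromℕ m) 1ℚ) (next (climb m))

  u≤q+m : u ℚ.≤ q ℚ.+ fromℕ m
  u≤q+m = subst (ℚ._≤ q ℚ.+ fromℕ m) q+[u-q]≡u (ℚ.+-monoʳ-≤ q le)
    where
    q+[u-q]≡u : q ℚ.+ (u ℚ.- q) ≡ u
    q+[u-q]≡u = begin
      q ℚ.+ (u ℚ.- q)        ≡⟨ ℚ.+-comm q (u ℚ.- q) ⟩
      (u ℚ.- q) ℚ.+ q        ≡⟨ ℚ.+-assoc u (ℚ.- q) q ⟩
      u ℚ.+ (ℚ.- q ℚ.+ q)    ≡⟨ cong (u ℚ.+_) (ℚ.+-inverseˡ q) ⟩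
      u ℚ.+ 0ℚ               ≡⟨ ℚ.+-identityʳ u ⟩
      u                      ∎
      where open ≡-Reasoning

-- The smaller of two intermediate points would do, but it cannot be selected by deciding an order;
-- either outcome of cotransitivity yields a suitable point.
<ᴿ-common-upper : ∀ {x y z} → x <ᴿ y → x <ᴿ z → ∃[ m ] (x <ᴿ m × m <ᴿ y × m <ᴿ z)
<ᴿ-common-upper {x} {y} {z} x<y x<z
  with m , x<m , m<y ← <ᴿ-dense {x} {y} x<y | m′ , x<m′ , m′<z ← <ᴿ-dense {x} {z} x<z
  with <ᴿ-cotrans {m′} {z} m′<z m
... | inj₁ m′<m = m′ , x<m′ , <ᴿ-trans {m′} {m} {y} m′<m m<y , m′<z
... | inj₂ m<z  = m , x<m , m<y , m<z

-- Ranks of the ends of unit intervals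

module _ {C : Set} {P : C → Set} (P? : ∀ c → Dec (P c)) where

  countNot : List C → ℕ
  countNot []       = 0
  countNot (c ∷ cs) with P? c
  ... | yes _ = countNot cs
  ... | no  _ = suc (countNot cs)

  countNot≤length : ∀ cs → countNot cs ≤ length cs
  countNot≤length [] = z≤n
  countNot≤length (c ∷ cs) with P? c
  ... | yes _ = m≤n⇒m≤1+n (countNot≤length cs)
  ... | no  _ = s≤s (countNot≤length cs)

  countNot-positive : ∀ {c cs} → c ∈ cs → ¬ P c → 0 < countNot cs
  countNot-positive {cs = d ∷ cs} c∈ ¬Pc with P? d
  countNot-positive (here refl) ¬Pc | yes Pc = contradiction Pc ¬Pc
  countNot-positive (there c∈)  ¬Pc | yes _  = countNot-positive c∈ ¬Pc
  ... | no _ = s≤s z≤n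

module _ {C : Set} {P Q : C → Set} (P? : ∀ c → Dec (P c)) (Q? : ∀ c → Dec (Q c))
         (Q⊆P : ∀ {c} → Q c → P c) where

  countNot-mono : ∀ cs → countNot P? cs ≤ countNot Q? cs
  countNot-mono [] = z≤n
  countNot-mono (c ∷ cs) with P? c | Q? c
  ... | yes _  | yes _  = countNot-mono cs
  ... | yes _  | no _   = m≤n⇒m≤1+n (countNot-mono cs)
  ... | no ¬Pc | yes Qc = contradiction (Q⊆P Qc) ¬Pc
  ... | no _   | no _   = s≤s (countNot-mono cs)

  countNot-strict : ∀ {c cs} → c ∈ cs → P c → ¬ Q c → countNot P? cs < countNot Q? cs
  countNot-strict {cs = d ∷ cs} c∈ Pc ¬Qc with P? d | Q? d
  countNot-strict (here refl) Pc ¬Qc | yes _  | yes Qc = contradiction Qc ¬Qc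
  countNot-strict (there c∈)  Pc ¬Qc | yes _  | yes _  = countNot-strict c∈ Pc ¬Qc
  countNot-strict {cs = d ∷ cs} c∈ Pc ¬Qc | yes _ | no _ = s≤s (countNot-mono cs)
  countNot-strict c∈ Pc ¬Qc | no ¬Pd | yes Qd = contradiction (Q⊆P Qd) ¬Pd
  countNot-strict (here refl) Pc ¬Qc | no ¬Pc | no _  = contradiction Pc ¬Pc
  countNot-strict (there c∈)  Pc ¬Qc | no _   | no _  = s≤s (countNot-strict c∈ Pc ¬Qc)

extremum : ∀ {C : Set} {P : C → Set} (P? : ∀ c → Dec (P c)) {_≼_ : C → C → Set} →
  (∀ a b → a ≼ b ⊎ b ≼ a) → (∀ {a b c} → a ≼ b → b ≼ c → a ≼ c) →
  ∀ cs {c₀} → c₀ ∈ cs → P c₀ → ∃[ m ] (P m × ∀ {c} → c ∈ cs → P c → m ≼ c)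
extremum {C} {P} P? {_≼_} total transitive cs {c₀} c₀∈ Pc₀ =
  let m , Pm , _ , min = go cs c₀ Pc₀ in m , Pm , min
  where
  ≼-refl : ∀ c → c ≼ c
  ≼-refl c with total c c
  ... | inj₁ c≼c = c≼c
  ... | inj₂ c≼c = c≼c

  go : ∀ cs d → P d → ∃[ m ] (P m × m ≼ d × ∀ {c} → c ∈ cs → P c → m ≼ c)
  go [] d Pd = d , Pd , ≼-refl d , λ ()
  go (e ∷ cs) d Pd with go cs d Pd | P? e
  ... | m , Pm , m≼d , min | no ¬Pe = m , Pm , m≼d , λ where
    (here refl) Pe → contradiction Pe ¬Pe
    (there c∈)  Pc → min c∈ Pc
  ... | m , Pm , m≼d , min | yes Pe with total m e
  ...   | inj₁ m≼e = m , Pm , m≼d , λ where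
    (here refl) _  → m≼e
    (there c∈)  Pc → min c∈ Pc
  ...   | inj₂ e≼m = e , Pe , transitive e≼m m≼d , λ where
    (here refl) _  → ≼-refl e
    (there c∈)  Pc → transitive e≼m (min c∈ Pc)

coord : ∀ {n} → (Fin n → ℝ) → Fin n ⊎ Fin n → ℝ
coord p (inj₁ i) = p i
coord p (inj₂ i) = p i +1

module Ranking {n} (p : Fin n → ℝ) (_<?ᴿ_ : ∀ a b → Dec (coord p a <ᴿ coord p b)) where

  End : Set
  End = Fin n ⊎ Fin n

  ends : List End
  ends = map inj₁ (allFin n) ++ map inj₂ (allFin n)

  ∈-ends : ∀ a → a ∈ ends
  ∈-ends (inj₁ i) = ∈-++⁺ˡ (∈-map⁺ inj₁ (∈-allFin i))
  ∈-ends (inj₂ i) = ∈-++⁺ʳ (map inj₁ (allFin n)) (∈-map⁺ inj₂ (∈-allFin i))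

  height : ℕ
  height = length ends

  -- The number of ends that are at most `x`. An end counts itself, so its rank is positive; `x`
  -- need not be an end, which allows ranking an arbitrary sweep line.
  rankOf : ∀ x → (∀ a → Dec (x <ᴿ coord p a)) → ℕ
  rankOf x x<? = countNot x<? ends

  rankOf-mono : ∀ {x y} x<? y<? → x ≤ᴿ y → rankOf x x<? ≤ rankOf y y<?
  rankOf-mono {x} {y} x<? y<? x≤y =
    countNot-mono x<? y<? (λ {c} → ≤-<ᴿ-trans {x} {y} {coord p c} x≤y) ends

  rank : End → ℕ
  rank a = rankOf (coord p a) (a <?ᴿ_)

  rankOf-strict : ∀ {x} x<? b → x <ᴿ coord p b → rankOf x x<? < rank b
  rankOf-strict {x} x<? b x<b =
    countNot-strict x<? (b <?ᴿ_) (λ {c} → <ᴿ-trans {x} {coord p b} {coord p c} x<b) (∈-ends b) x<b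
      (<ᴿ-irrefl {coord p b})

  rank-< : ∀ a b → coord p a <ᴿ coord p b → rank a < rank b
  rank-< a b = rankOf-strict {coord p a} (a <?ᴿ_) b

  rank-<⁻ : ∀ a b → rank a < rank b → coord p a <ᴿ coord p b
  rank-<⁻ a b ra<rb with a <?ᴿ b
  ... | yes a<b = a<b
  ... | no  a≮b = contradiction ra<rb
    (≤⇒≯ (rankOf-mono {coord p b} {coord p a} (b <?ᴿ_) (a <?ᴿ_) a≮b))

  rank-≤ : ∀ a b → coord p a ≤ᴿ coord p b → rank a ≤ rank b
  rank-≤ a b = rankOf-mono {coord p a} {coord p b} (a <?ᴿ_) (b <?ᴿ_)

  rank-≤⁻ : ∀ a b → rank a ≤ rank b → coord p a ≤ᴿ coord p b
  rank-≤⁻ a b ra≤rb b<a = <⇒≱ (rank-< b a b<a) ra≤rb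

  rank≤height : ∀ a → rank a ≤ height
  rank≤height a = countNot≤length (a <?ᴿ_) ends

  lo hi : Fin n → ℕ
  lo i = rank (inj₁ i)
  hi i = rank (inj₂ i)

  0<lo : ∀ i → 0 < lo i
  0<lo i = countNot-positive (inj₁ i <?ᴿ_) (∈-ends (inj₁ i)) (<ᴿ-irrefl {p i})

  p<p+1 : ∀ i → p i <ᴿ p i +1
  p<p+1 i with inj₁ i <?ᴿ inj₂ i
  ... | yes lt = lt
  ... | no ¬lt = contradiction ¬lt (x<x+1 (p i))

  lo<hi : ∀ i → lo i < hi i
  lo<hi i = rank-< (inj₁ i) (inj₂ i) (p<p+1 i)

  -- Equality of the side lengths enters here: an inequality between right ends cancels to one
  -- between left ends.
  unit : ∀ i j → lo i ≤ lo j → hi i ≤ hi j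
  unit i j lo≤ = rank-≤ (inj₂ i) (inj₂ j)
    (λ hi< → rank-≤⁻ (inj₁ i) (inj₁ j) lo≤ (+1-cancel-< {p j} {p i} hi<))

  -- Of two unit intervals the one that starts later also ends later, so the overlap reaches from
  -- its start to the end of the other.
  common-point : ∀ {i j} → lo i < hi j → lo j < hi i →
    ∃[ x ] ((p i <ᴿ x × x <ᴿ p i +1) × (p j <ᴿ x × x <ᴿ p j +1))
  common-point {i} {j} i<j j<i with ≤-total (lo i) (lo j)
  ... | inj₁ lo≤
    with x , j<x , x<i ← <ᴿ-dense {p j} {p i +1} (rank-<⁻ (inj₁ j) (inj₂ i) j<i) =
    x , (≤-<ᴿ-trans {p i} {p j} {x} (rank-≤⁻ (inj₁ i) (inj₁ j) lo≤) j<x , x<i)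
      , (j<x , <-≤ᴿ-trans {x} {p i +1} {p j +1} x<i (rank-≤⁻ (inj₂ i) (inj₂ j) (unit i j lo≤)))
  ... | inj₂ lo≥
    with x , i<x , x<j ← <ᴿ-dense {p i} {p j +1} (rank-<⁻ (inj₁ i) (inj₂ j) i<j) =
    x , (i<x , <-≤ᴿ-trans {x} {p j +1} {p i +1} x<j (rank-≤⁻ (inj₂ j) (inj₂ i) (unit j i lo≥)))
      , (≤-<ᴿ-trans {p j} {p i} {x} (rank-≤⁻ (inj₁ j) (inj₁ i) lo≥) i<x , x<j)

  -- The open interval between adjacent end coordinates that belongs to time `k`. No end lies inside
  -- it, so all its lines meet the interiors of the same squares.
  record Cell (k : ℕ) : Set where
    field
      below above : End
      below≤k     : rank below ≤ k
      k<above     : k < rank above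
      greatest    : ∀ c → rank c ≤ k → rank c ≤ rank below
      least       : ∀ c → k < rank c → rank above ≤ rank c

    below<above : coord p below <ᴿ coord p above
    below<above = rank-<⁻ below above (≤-<-trans below≤k k<above)

  cell : ∀ {k a b} → rank a ≤ k → k < rank b → Cell k
  cell {k} {a} {b} a≤k k<b
    with m , m≤k , greatest ← extremum (λ c → rank c ≤? k) {λ c d → rank d ≤ rank c}
           (λ c d → ≤-total (rank d) (rank c)) (λ le le′ → ≤-trans le′ le) ends (∈-ends a) a≤k
       | M , k<M , least ← extremum (λ c → k <? rank c) {λ c d → rank c ≤ rank d}
           (λ c d → ≤-total (rank c) (rank d)) ≤-trans ends (∈-ends b) k<b = record
    { below = m ; above = M ; below≤k = m≤k ; k<above = k<M
    ; greatest = λ c → greatest (∈-ends c)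
    ; least = λ c → least (∈-ends c)
    }

-- Bands of visibility

Comparisons : ∀ {n} → (Fin n → ℝ) → Set
Comparisons p = ∀ a b → Dec (coord p a <ᴿ coord p b)

-- Double negation commutes with finite conjunctions, so finitely many undecided comparisons may be
-- assumed decided together.
¬¬-ends : ∀ {n} {P : Fin n ⊎ Fin n → Set} → (∀ e → ¬ ¬ P e) → ¬ ¬ (∀ e → P e)
¬¬-ends ¬¬P ¬∀P =
  ¬¬-Fin (¬¬P ∘ inj₁) λ P₁ → ¬¬-Fin (¬¬P ∘ inj₂) λ P₂ → ¬∀P [ P₁ , P₂ ]
  where
  ¬¬-Fin : ∀ {n} {P : Fin n → Set} → (∀ i → ¬ ¬ P i) → ¬ ¬ (∀ i → P i)
  ¬¬-Fin = Fin.sequence (RawMonad.rawApplicative ¬¬-Monad)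

¬¬-comparisons : ∀ {n} (p : Fin n → ℝ) → ¬ ¬ Comparisons p
¬¬-comparisons p = ¬¬-ends (λ a → ¬¬-ends (λ b → ¬¬-excluded-middle))

-- The `Y` ranks are the times of the sweep by a horizontal line, and the `X` ranks order the stack
-- along it. Vertical bands are obtained from the layout with axes swapped.
module Visibility {n} (S : Layout n)
                  (bottom<? : Comparisons (bottom ∘ S)) (left<? : Comparisons (left ∘ S))
                  (disj : DisjointInteriors S) where

  module Y = Ranking (bottom ∘ S) bottom<?
  module X = Ranking (left ∘ S) left<?
  module B = Bars Fin._≟_ Y.lo Y.hi Y.0<lo Y.lo<hi
  open B using (Alive; alive; alive⁻; alive⁺)

  -- Overlap in both coordinates would give a point common to the two interiors.
  separated : ∀ {i j} → i ≢ j → Y.lo i < Y.hi j → Y.lo j < Y.hi i →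
              X.hi i ≤ X.lo j ⊎ X.hi j ≤ X.lo i
  separated {i} {j} i≢j i<j j<i with X.hi i ≤? X.lo j | X.hi j ≤? X.lo i
  ... | yes le | _      = inj₁ le
  ... | no _   | yes le = inj₂ le
  ... | no ¬le | no ¬le′
    with y , yi , yj ← Y.common-point i<j j<i
       | x , xi , xj ← X.common-point (≰⇒> ¬le′) (≰⇒> ¬le) =
    ⊥-elim (disj i j i≢j (x , y) ((xi , yi) , (xj , yj)))

  alive-separated : ∀ {k i j} → i ≢ j → Alive k i → Alive k j →
                    X.hi i ≤ X.lo j ⊎ X.hi j ≤ X.lo i
  alive-separated i≢j (i≤k , k<i) (j≤k , k<j) =
    separated i≢j (≤-<-trans i≤k k<j) (≤-<-trans j≤k k<i)

  lo≤⇒hi≤lo : ∀ {k i j} → i ≢ j → Alive k i → Alive k j → X.lo i ≤ X.lo j → X.hi i ≤ X.lo j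
  lo≤⇒hi≤lo {k} {i} {j} i≢j ai aj le with alive-separated i≢j ai aj
  ... | inj₁ i≤j = i≤j
  ... | inj₂ j≤i = contradiction (≤-trans j≤i le) (<⇒≱ (X.lo<hi j))

  alive-lo-injective : ∀ {k u v} → alive k u ≡ true → alive k v ≡ true → X.lo u ≡ X.lo v → u ≡ v
  alive-lo-injective {k} {u} {v} au av eq with u Fin.≟ v
  ... | yes u≡v = u≡v
  ... | no  u≢v = contradiction
    (≤-trans (lo≤⇒hi≤lo u≢v (alive⁻ k u au) (alive⁻ k v av) (≤-reflexive eq))
             (≤-reflexive (sym eq)))
    (<⇒≱ (X.lo<hi u))

  private
    byLeft : DecTotalOrder _ _ _
    byLeft = On.decTotalOrder ≤-decTotalOrder X.lo

  open Sort byLeft using (sort; sort-↭; sort-↗)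

  stack : List (Fin n)
  stack = sort (allFin n)

  ∈-stack : ∀ i → i ∈ stack
  ∈-stack i = ∈-resp-↭ (↭-sym (sort-↭ (allFin n))) (∈-allFin i)

  length-stack : length stack ≡ n
  length-stack = trans (↭-length (sort-↭ (allFin n))) (length-tabulate id)

  stack-sorted : AllPairs (Below X.lo) stack
  stack-sorted = AllPairs.zip
    (Sorted⇒AllPairs (DecTotalOrder.totalOrder byLeft) (sort-↗ (allFin n)) , unique)
    where
    unique : Unique stack
    unique = Permutation.Unique-resp-↭ (setoid (Fin n))
      (↭⇒↭ₛ (↭-sym (sort-↭ (allFin n)))) (allFin⁺ n)

  -- The band is the cell of time `k`. A square obstructing one of its lines is alive at `k`;
  -- `unblocked` and disjointness then keep it out of the gap between `i` and `j`.
  neighbours⇒band : ∀ k {i j} → (i , j) ∈ consecutive (alive k) nothing stack →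
                    i ≢ j × HorizontalBand S i j
  neighbours⇒band k {i} {j} ij∈ =
    proj₂ below , coord (bottom ∘ S) C.below , coord (bottom ∘ S) C.above , C.below<above ,
    λ y a<y y<b → meets ai y a<y y<b , meets aj y a<y y<b , clear y a<y y<b
    where
    open Neighbours (consecutive⇒neighbours X.lo (alive k) nothing stack stack-sorted (λ ()) ij∈)
    ai = alive⁻ k i alive-lower
    aj = alive⁻ k j alive-upper
    i≤j : X.hi i ≤ X.lo j
    i≤j = lo≤⇒hi≤lo (proj₂ below) ai aj (proj₁ below)
    module C = Y.Cell (Y.cell {k} {inj₁ i} {inj₂ i} (proj₁ ai) (proj₂ ai))
    a b : ℝ
    a = coord (bottom ∘ S) C.below
    b = coord (bottom ∘ S) C.above

    meets : ∀ {v} → Alive k v → ∀ y → a <ᴿ y → y <ᴿ b → MeetsInteriorAt y (S v)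
    meets {v} (v≤k , k<v) y a<y y<b =
      let x , l<x , x<r = <ᴿ-dense {left (S v)} {right (S v)} (X.p<p+1 v) in
      x , (l<x , x<r)
        , ≤-<ᴿ-trans {bottom (S v)} {a} {y}
            (Y.rank-≤⁻ (inj₁ v) C.below (C.greatest (inj₁ v) v≤k)) a<y
        , <-≤ᴿ-trans {y} {b} {top (S v)} y<b
            (Y.rank-≤⁻ C.above (inj₂ v) (C.least (inj₂ v) k<v))

    clear : ∀ y → a <ᴿ y → y <ᴿ b → ∀ x → BetweenX (S i) (S j) x →
            ∀ u → u ≢ i → u ≢ j → ¬ Interior (S u) (x , y)
    -- Since `i` lies to the left of `j`, the reversed segment is empty.
    clear y a<y y<b x (inj₂ (j≤x , x≤i)) u _ _ _ =
      <ᴿ-irrefl {left (S i)}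
        (<-≤ᴿ-trans {left (S i)} {right (S j)} {left (S i)}
          (X.rank-<⁻ (inj₁ i) (inj₂ j) (<-trans (<-≤-trans (X.lo<hi i) i≤j) (X.lo<hi j)))
          (≤ᴿ-trans {right (S j)} {x} {left (S i)} j≤x x≤i))
    clear y a<y y<b x (inj₁ (i≤x , x≤j)) u u≢i u≢j ((l<x , x<r) , (b<y , y<t)) =
      [ u-left , u-right ]′ (unblocked (∈-stack u) (alive⁺ k u au))
      where
      au : Alive k u
      au = ≮⇒≥ (λ k<u → <ᴿ-irrefl {y} (<-≤ᴿ-trans {y} {b} {y} y<b
               (<⇒≤ᴿ {b} {y} (≤-<ᴿ-trans {b} {bottom (S u)} {y}
                 (Y.rank-≤⁻ C.above (inj₁ u) (C.least (inj₁ u) k<u)) b<y))))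
         , ≰⇒> (λ u≤k → <ᴿ-irrefl {y} (<-≤ᴿ-trans {y} {top (S u)} {y} y<t
               (<⇒≤ᴿ {top (S u)} {y} (≤-<ᴿ-trans {top (S u)} {a} {y}
                 (Y.rank-≤⁻ (inj₂ u) C.below (C.greatest (inj₂ u) u≤k)) a<y))))
      u-left : X.lo u ≤ X.lo i → ⊥
      u-left le = <⇒≱ (X.lo<hi i)
        (≤-trans (X.rank-≤ (inj₂ i) (inj₂ u) i≤u) (lo≤⇒hi≤lo u≢i au ai le))
        where
        i≤u : right (S i) ≤ᴿ right (S u)
        i≤u = ≤ᴿ-trans {right (S i)} {x} {right (S u)} i≤x (<⇒≤ᴿ {x} {right (S u)} x<r)
      u-right : X.lo j ≤ X.lo u → ⊥
      u-right le = <⇒≱ (X.lo<hi j)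
        (≤-trans (lo≤⇒hi≤lo (≢-sym u≢j) aj au le) (X.rank-≤ (inj₁ u) (inj₁ j) u≤j))
        where
        u≤j : left (S u) ≤ᴿ left (S j)
        u≤j = ≤ᴿ-trans {left (S u)} {x} {left (S j)} (<⇒≤ᴿ {left (S u)} {x} l<x) x≤j

  -- The line y = y₀ may run along the bottom of a square, hence the passage to a
  -- slightly higher line of the band.
  module _ (y₀ b : ℝ) (y₀<b : y₀ <ᴿ b) (y₀<? : ∀ e → Dec (y₀ <ᴿ coord (bottom ∘ S) e)) where

    level : ℕ
    level = Y.rankOf y₀ y₀<?

    on-line⇒alive : ∀ {v} → MeetsInteriorAt y₀ (S v) → Alive level v
    on-line⇒alive {v} (_ , _ , b<y , y<t) =
      Y.rankOf-mono {bottom (S v)} {y₀} (bottom<? (inj₁ v)) y₀<? (<⇒≤ᴿ {bottom (S v)} {y₀} b<y) ,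
      Y.rankOf-strict {y₀} y₀<? (inj₂ v) y<t

    alive⇒bottom≤ : ∀ {u} → Alive level u → bottom (S u) ≤ᴿ y₀
    alive⇒bottom≤ {u} (u≤k , _) y<b = <⇒≱ (Y.rankOf-strict {y₀} y₀<? (inj₁ u) y<b) u≤k

    alive⇒<top : ∀ {u} → Alive level u → y₀ <ᴿ top (S u)
    alive⇒<top {u} (_ , k<u) with y₀<? (inj₂ u)
    ... | yes y<t = y<t
    ... | no  y≮t = contradiction
      (Y.rankOf-mono {top (S u)} {y₀} (bottom<? (inj₂ u)) y₀<? y≮t) (<⇒≱ k<u)

    -- An alive square with its left side strictly between those of `i` and `j` would obstruct some
    -- line of the band above `y₀`.
    clear⇒consecutive : ∀ {i j} → i ≢ j → Alive level i → Alive level j →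
      (∀ y → y₀ <ᴿ y → y <ᴿ b → ∀ x → right (S i) ≤ᴿ x → x ≤ᴿ left (S j) →
        ∀ u → u ≢ i → u ≢ j → ¬ Interior (S u) (x , y)) →
      X.hi i ≤ X.lo j → (i , j) ∈ consecutive (alive level) nothing stack
    clear⇒consecutive {i} {j} i≢j ai aj clear i≤j =
      neighbours⇒consecutive X.lo (alive level) alive-lo-injective
        (alive⁺ level i ai) (alive⁺ level j aj) unblocked nothing stack stack-sorted
        (<-≤-trans (X.lo<hi i) i≤j) (∈-stack i) (∈-stack j)
      where
      between : ∀ {u} → Alive level u → X.lo i < X.lo u → X.lo u < X.lo j → ⊥
      between {u} au i<u u<j =
        let y , y₀<y , y<b , y<t = <ᴿ-common-upper {y₀} {b} {top (S u)} y₀<b (alive⇒<top au)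
            x , l<x , x<r = <ᴿ-dense {left (S u)} {right (S u)} (X.p<p+1 u) in
        clear y y₀<y y<b x
          (<⇒≤ᴿ {right (S i)} {x} (≤-<ᴿ-trans {right (S i)} {left (S u)} {x}
            (X.rank-≤⁻ (inj₂ i) (inj₁ u) (lo≤⇒hi≤lo (≢-sym u≢i) ai au (<⇒≤ i<u))) l<x))
          (<⇒≤ᴿ {x} {left (S j)} (<-≤ᴿ-trans {x} {right (S u)} {left (S j)} x<r
            (X.rank-≤⁻ (inj₂ u) (inj₁ j) (lo≤⇒hi≤lo u≢j au aj (<⇒≤ u<j)))))
          u u≢i u≢j
          ((l<x , x<r) , ≤-<ᴿ-trans {bottom (S u)} {y₀} {y} (alive⇒bottom≤ au) y₀<y , y<t)
        where
        u≢i : u ≢ i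
        u≢i refl = <-irrefl refl i<u
        u≢j : u ≢ j
        u≢j refl = <-irrefl refl u<j

      unblocked : ∀ {u} → alive level u ≡ true → X.lo u ≤ X.lo i ⊎ X.lo j ≤ X.lo u
      unblocked {u} alive-u with X.lo u ≤? X.lo i | X.lo j ≤? X.lo u
      ... | yes le | _      = inj₁ le
      ... | no _   | yes le = inj₂ le
      ... | no u≰i | no j≰u = ⊥-elim (between (alive⁻ level u alive-u) (≰⇒> u≰i) (≰⇒> j≰u))

  sighted : List (Fin n × Fin n)
  sighted = B.sightings stack Y.height

  -- Doubly negated because the line `y₀` has to be compared with all ends; membership in `sighted`
  -- is decidable, so nothing is lost.
  band⇒sighted : ∀ {v w} → v ≢ w → HorizontalBand S v w →
                 ¬ ¬ ((v , w) ∈ sighted ⊎ (w , v) ∈ sighted)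
  band⇒sighted {v} {w} v≢w (a , b , a<b , band) ¬sighted =
    let y₀ , a<y₀ , y₀<b = <ᴿ-dense {a} {b} a<b
        meets-v , meets-w , _ = band y₀ a<y₀ y₀<b
    in ¬¬-ends (λ e → ¬¬-excluded-middle {A = y₀ <ᴿ coord (bottom ∘ S) e}) λ y₀<? →
    let k = level y₀ b y₀<b y₀<?
        av = on-line⇒alive y₀ b y₀<b y₀<? meets-v
        aw = on-line⇒alive y₀ b y₀<b y₀<? meets-w
        in-band : ∀ y → y₀ <ᴿ y → a <ᴿ y
        in-band y = <ᴿ-trans {a} {y₀} {y} a<y₀
        seen : ∀ {z} → z ∈ consecutive (alive k) nothing stack → z ∈ sighted
        seen z∈ = B.sightings-mono stack (countNot≤length y₀<? Y.ends)
                    (B.consecutive⇒sighted stack k z∈)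
    in ¬sighted ([ (λ v≤w → inj₁ (seen (clear⇒consecutive y₀ b y₀<b y₀<? v≢w av aw
                     (λ y y₀<y y<b x v≤x x≤w u u≢v u≢w →
                       proj₂ (proj₂ (band y (in-band y y₀<y) y<b)) x (inj₁ (v≤x , x≤w)) u u≢v u≢w)
                     v≤w)))
                 , (λ w≤v → inj₂ (seen (clear⇒consecutive y₀ b y₀<b y₀<? (≢-sym v≢w) aw av
                     (λ y y₀<y y<b x w≤x x≤v u u≢w u≢v →
                       proj₂ (proj₂ (band y (in-band y y₀<y) y<b)) x (inj₂ (w≤x , x≤v)) u u≢v u≢w)
                     w≤v)))
                 ]′ (alive-separated v≢w av aw))

  firsts lasts : ℕ
  firsts = B.changes (B.firstAlive stack) Y.height
  lasts  = B.changes (B.lastAlive stack) Y.height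

  sighted-bound : (c : Fin n → Bool) → (∀ {v w} → v ≢ w → HorizontalBand S v w → c v ≢ c w) →
                  2 * length sighted + (firsts + lasts) ≤ 4 * n
  sighted-bound c proper =
    subst (λ m → 2 * length sighted + (firsts + lasts) ≤ 4 * m) length-stack
      (B.sightings-bound c stack
        (λ k → All.tabulate (λ z∈ → let v≢w , band = neighbours⇒band k z∈ in proper v≢w band))
        Y.height)

-- Counting the edges

-- With `m` the smaller factor and `t = m + d`, the other is at most `m + 2d`, and `m(m + 2d)` falls
-- short of the square of `t` by the square of `d`.
m+n≤2t⇒m*n≤t*t : ∀ m n {t} → m + n ≤ t + t → m * n ≤ t * t
m+n≤2t⇒m*n≤t*t m n {t} sum≤ =
  [ (λ m≤t → smaller {m} {n} {t} m≤t sum≤) , larger ]′ (≤-total m t)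
  where
  open ≤-Reasoning
  square : ∀ m d → m * (m + (d + d)) + d * d ≡ (m + d) * (m + d)
  square = solve-∀
  regroup : ∀ m d → (m + d) + (m + d) ≡ m + (m + (d + d))
  regroup = solve-∀

  smaller : ∀ {m n t} → m ≤ t → m + n ≤ t + t → m * n ≤ t * t
  smaller {m} {n} m≤t sum≤ with d , refl ← m≤n⇒∃[o]m+o≡n m≤t = begin
    m * n
      ≤⟨ *-monoʳ-≤ m (+-cancelˡ-≤ m n _ (≤-trans sum≤ (≤-reflexive (regroup m d)))) ⟩
    m * (m + (d + d))          ≤⟨ m≤m+n _ (d * d) ⟩
    m * (m + (d + d)) + d * d  ≡⟨ square m d ⟩
    (m + d) * (m + d)          ∎

  larger : t ≤ m → m * n ≤ t * t
  larger t≤m = subst (_≤ t * t) (*-comm n m)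
    (smaller {n} {m} {t} (+-cancelˡ-≤ t n t (≤-trans (+-monoˡ-≤ n t≤m) sum≤))
      (subst (_≤ t + t) (+-comm m n) sum≤))

-- Otherwise `w + h` is at most `2t` with `t` one less than the root, so `n` is at most `t * t`,
-- against minimality of the root. The `suc` allows for odd `w + h`, as in `n = 2`, `w = 1`,
-- `h = 2`.
⌈√⌉-AM-GM : ∀ {n w h} → n ≤ w * h → 2 * ⌈√ n ⌉ ≤ suc (w + h)
⌈√⌉-AM-GM {n} {w} {h} n≤wh = ≮⇒≥ λ lt → go ⌈√ n ⌉ refl lt
  where
  go : ∀ s → ⌈√ n ⌉ ≡ s → suc (w + h) < 2 * s → ⊥
  go (suc t) eq (s≤s lt) = <⇒≱ (n<1+n t) (subst (_≤ t) eq
    (⌈√⌉-least n t (≤-trans n≤wh (m+n≤2t⇒m*n≤t*t w h {t} w+h≤2t))))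
    where
    lemma : ∀ t → t + suc (t + 0) ≡ 1 + (t + t)
    lemma = solve-∀
    w+h≤2t : w + h ≤ t + t
    w+h≤2t = +-cancelˡ-≤ 1 _ _ (≤-trans lt (≤-reflexive (lemma t)))

unique-⊆⇒length≤ : ∀ {A : Set} {xs ys : List A} → Unique xs →
  (∀ {z} → z ∈ xs → z ∈ ys) → length xs ≤ length ys
unique-⊆⇒length≤ {xs = []} _ _ = z≤n
unique-⊆⇒length≤ {xs = x ∷ xs} {ys} (x∉xs ∷ unique) xs⊆ys
  with as , bs , refl ← ∈-∃++ (xs⊆ys (here refl)) = begin
  suc (length xs)              ≤⟨ s≤s (unique-⊆⇒length≤ unique skip-x) ⟩
  suc (length (as ++ bs))      ≡⟨ cong suc (length-++ as) ⟩
  suc (length as + length bs)  ≡⟨ +-suc (length as) (length bs) ⟨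
  length as + suc (length bs)  ≡⟨ length-++ as ⟨
  length (as ++ x ∷ bs)        ∎
  where
  open ≤-Reasoning
  skip-x : ∀ {z} → z ∈ xs → z ∈ as ++ bs
  skip-x {z} z∈ with ∈-++⁻ as (xs⊆ys (there z∈))
  ... | inj₁ z∈as         = ∈-++⁺ˡ z∈as
  ... | inj₂ (here refl)  = contradiction refl (All.lookup x∉xs z∈)
  ... | inj₂ (there z∈bs) = ∈-++⁺ʳ as z∈bs

module _ {n} (G : Graph n) where
  open Graph G

  edges-unique : Unique (edges G)
  edges-unique = filter⁺ _ (cartesianProduct⁺ (allFin⁺ n) (allFin⁺ n))

  -- Sighted pairs follow the position of the squares, listed edges the order of the indices; this
  -- normalises the former to the latter.
  increasing : Fin n × Fin n → Fin n × Fin n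
  increasing (i , j) with i Fin.<? j
  ... | yes _ = i , j
  ... | no  _ = j , i

  ∣E∣≤length : ∀ (zs : List (Fin n × Fin n)) →
    (∀ i j → Adj i j → (i , j) ∈ zs ⊎ (j , i) ∈ zs) → ∣E G ∣ ≤ length zs
  ∣E∣≤length zs covered =
    ≤-trans (unique-⊆⇒length≤ edges-unique edge∈) (≤-reflexive (length-map increasing zs))
    where
    edge∈ : ∀ {e} → e ∈ edges G → e ∈ map increasing zs
    edge∈ {i , j} e∈
      with _ , i<j , ij ← ∈-filter⁻ _ {xs = cartesianProduct (allFin n) (allFin n)} e∈
      with covered i j ij
    ... | inj₁ ij∈ = subst (_∈ map increasing zs) keep (∈-map⁺ increasing ij∈)
      where
      keep : increasing (i , j) ≡ (i , j)
      keep with i Fin.<? j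
      ... | yes _  = refl
      ... | no i≮j = contradiction i<j i≮j
    ... | inj₂ ji∈ = subst (_∈ map increasing zs) flip (∈-map⁺ increasing ji∈)
      where
      flip : increasing (j , i) ≡ (i , j)
      flip with j Fin.<? i
      ... | yes j<i = contradiction i<j (<-asym j<i)
      ... | no _    = refl

-- Combining the two directions

module Bound {n} (G : Graph n) (colour : Fin n → Bool)
             (proper : ∀ v w → Graph.Adj G v w → colour v ≢ colour w)
             (S : Layout n) (disj : DisjointInteriors S)
             (represents : ∀ v w → v ≢ w →
               Graph.Adj G v w ⇔ (HorizontalBand S v w ⊎ VerticalBand S v w))
             (bottom<? : Comparisons (bottom ∘ S)) (left<? : Comparisons (left ∘ S)) where
  open Graph G

  swapped-disjoint : DisjointInteriors (swapAxes ∘ S)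
  swapped-disjoint v w v≢w (x , y) (in-v , in-w) = disj v w v≢w (y , x) (swap in-v , swap in-w)

  module H = Visibility S bottom<? left<? disj
  module V = Visibility (swapAxes ∘ S) left<? bottom<? swapped-disjoint

  sighted : List (Fin n × Fin n)
  sighted = H.sighted ++ V.sighted

  adjacent⇒sighted : ∀ i j → Adj i j → (i , j) ∈ sighted ⊎ (j , i) ∈ sighted
  adjacent⇒sighted i j ij =
    decidable-stable (((i , j) ∈? sighted) ⊎-dec ((j , i) ∈? sighted)) λ ¬sighted →
    [ (λ h → H.band⇒sighted i≢j h (¬sighted ∘ [ inj₁ ∘ ∈-++⁺ˡ , inj₂ ∘ ∈-++⁺ˡ ]′))
    , (λ v → V.band⇒sighted i≢j v
        (¬sighted ∘ [ inj₁ ∘ ∈-++⁺ʳ H.sighted , inj₂ ∘ ∈-++⁺ʳ H.sighted ]′))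
    ]′ (Equivalence.to (represents i j i≢j) ij)
    where
    open DecMembership (≡-dec (Fin._≟_ {n}) (Fin._≟_ {n})) using (_∈?_)
    i≢j : i ≢ j
    i≢j i≡j = irrefl i≡j ij

  H-bound : 2 * length H.sighted + (H.firsts + H.lasts) ≤ 4 * n
  H-bound = H.sighted-bound colour
    (λ {v} {w} v≢w band → proper v w (Equivalence.from (represents v w v≢w) (inj₁ band)))

  V-bound : 2 * length V.sighted + (V.firsts + V.lasts) ≤ 4 * n
  V-bound = V.sighted-bound colour
    (λ {v} {w} v≢w band → proper v w (Equivalence.from (represents v w v≢w) (inj₂ band)))

  module HU = H.B.Unit H.Y.unit {H.stack}
  module VU = V.B.Unit V.Y.unit {V.stack}

  module _ {f g} (f-sel : H.B.Selector H.stack f) (g-sel : V.B.Selector V.stack g) where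

    count-f count-g : ℕ
    count-f = H.B.changes f H.Y.height
    count-g = V.B.changes g V.Y.height

    -- Squares with the same label overlap in both directions.
    n≤product : n ≤ count-f * count-g
    n≤product = Fin.injective⇒≤ {f = label} injective
      where
      -- A further change takes place during the life of `i`, so the count before it is strictly
      -- less than the total.
      row<  : ∀ i → H.B.changes f (H.Y.lo i) < count-f
      row< i = <-≤-trans (HU.change-during f-sel (H.∈-stack i))
                 (H.B.changes-mono f (H.Y.rank≤height (inj₂ i)))

      column< : ∀ i → V.B.changes g (V.Y.lo i) < count-g
      column< i = <-≤-trans (VU.change-during g-sel (V.∈-stack i))
                    (V.B.changes-mono g (V.Y.rank≤height (inj₂ i)))

      label : Fin n → Fin (count-f * count-g)
      label i = combine (fromℕ< (row< i)) (fromℕ< (column< i))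

      same-row : ∀ {i j} → label i ≡ label j → H.B.changes f (H.Y.lo i) ≡ H.B.changes f (H.Y.lo j)
      same-row {i} {j} eq = Fin.fromℕ<-injective _ _ (row< i) (row< j)
        (Fin.combine-injectiveˡ _ (fromℕ< (column< i)) _ (fromℕ< (column< j)) eq)

      same-column : ∀ {i j} → label i ≡ label j →
        V.B.changes g (V.Y.lo i) ≡ V.B.changes g (V.Y.lo j)
      same-column {i} {j} eq = Fin.fromℕ<-injective _ _ (column< i) (column< j)
        (Fin.combine-injectiveʳ (fromℕ< (row< i)) _ (fromℕ< (row< j)) _ eq)

      injective : ∀ {i j} → label i ≡ label j → i ≡ j
      injective {i} {j} eq with i Fin.≟ j
      ... | yes i≡j = i≡j
      -- Overlap in rows forces the squares apart horizontally, while overlap in columns excludes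
      -- either side; `V.Y` and `H.X` rank the same coordinates.
      ... | no  i≢j = ⊥-elim (
        [ <⇒≱ (column-overlap {i} {j} eq) , <⇒≱ (column-overlap {j} {i} (sym eq)) ]′
        (H.separated i≢j (row-overlap {j} {i} (sym eq)) (row-overlap {i} {j} eq)))
        where
        row-overlap : ∀ {i j} → label i ≡ label j → H.Y.lo j < H.Y.hi i
        row-overlap {i} eq = HU.same-changes⇒overlap f-sel (H.∈-stack i) (same-row eq)
        column-overlap : ∀ {i j} → label i ≡ label j → V.Y.lo j < V.Y.hi i
        column-overlap {i} eq = VU.same-changes⇒overlap g-sel (V.∈-stack i) (same-column eq)

  edge-bound : ∣E G ∣ + 2 * ⌈√ n ⌉ ≤ 4 * n + 1
  edge-bound = *-cancelˡ-≤ 2 (begin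
    -- Doubling allows `⌈√⌉-AM-GM` to be used once for the first and once for the last squares; each
    -- use costs 1, whence the 1 in the bound after halving.
    2 * (∣E G ∣ + s)
      ≤⟨ *-monoʳ-≤ 2 (+-monoˡ-≤ s (∣E∣≤length G sighted adjacent⇒sighted)) ⟩
    2 * (length sighted + s)
      ≡⟨ cong (λ m → 2 * (m + s)) (length-++ H.sighted) ⟩
    2 * ((a + b) + s)
      ≡⟨ lemma a b s ⟩
    2 * a + 2 * b + (s + s)
      ≤⟨ +-monoʳ-≤ (2 * a + 2 * b) (+-mono-≤
           (⌈√⌉-AM-GM {n} {H.firsts} {V.firsts}
             (n≤product (H.B.firstAlive-selector H.stack) (V.B.firstAlive-selector V.stack)))
           (⌈√⌉-AM-GM {n} {H.lasts} {V.lasts}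
             (n≤product (H.B.lastAlive-selector H.stack) (V.B.lastAlive-selector V.stack)))) ⟩
    2 * a + 2 * b + (suc (H.firsts + V.firsts) + suc (H.lasts + V.lasts))
      ≡⟨ lemma′ a b H.firsts V.firsts H.lasts V.lasts ⟩
    (2 * a + (H.firsts + H.lasts)) + (2 * b + (V.firsts + V.lasts)) + 2
      ≤⟨ +-monoˡ-≤ 2 (+-mono-≤ H-bound V-bound) ⟩
    4 * n + 4 * n + 2
      ≡⟨ lemma″ n ⟩
    2 * (4 * n + 1) ∎)
    where
    open ≤-Reasoning
    a = length H.sighted
    b = length V.sighted
    s = 2 * ⌈√ n ⌉
    lemma : ∀ a b s → 2 * ((a + b) + s) ≡ 2 * a + 2 * b + (s + s)
    lemma = solve-∀
    lemma′ : ∀ a b f f′ l l′ → 2 * a + 2 * b + (suc (f + f′) + suc (l + l′))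
      ≡ (2 * a + (f + l)) + (2 * b + (f′ + l′)) + 2
    lemma′ = solve-∀
    lemma″ : ∀ n → 4 * n + 4 * n + 2 ≡ 2 * (4 * n + 1)
    lemma″ = solve-∀

theorem6p6 : ∀ (n : ℕ) → 7 ≤ n → (G : Graph n) → Bipartite G → IsURVG G →
    ∣E G ∣ ≤ 4 * n ∸ 2 * ⌈√ n ⌉ + 5
theorem6p6 n _ G (colour , proper) (S , disj , represents) =
  decidable-stable (_ ≤? _) λ ¬bound →
  ¬¬-comparisons (bottom ∘ S) λ bottom<? →
  ¬¬-comparisons (left ∘ S) λ left<? →
  ¬bound (begin
    ∣E G ∣
      ≤⟨ m+n≤o⇒m≤o∸n ∣E G ∣ (Bound.edge-bound G colour proper S disj represents bottom<? left<?) ⟩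
    -- The 1 may be moved out because the subtraction from `4 * n` does not truncate.
    4 * n + 1 ∸ 2 * ⌈√ n ⌉         ≡⟨ +-∸-comm 1 2√n≤4n ⟩
    4 * n ∸ 2 * ⌈√ n ⌉ + 1         ≤⟨ +-monoʳ-≤ (4 * n ∸ 2 * ⌈√ n ⌉) (s≤s z≤n) ⟩
    4 * n ∸ 2 * ⌈√ n ⌉ + 5         ∎)
  where
  open ≤-Reasoning
  2√n≤4n : 2 * ⌈√ n ⌉ ≤ 4 * n
  2√n≤4n = *-mono-≤ {2} {4} (s≤s (s≤s z≤n)) (⌈√n⌉≤n n)
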